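{- Let $E$ be an Archimedean homogeneous effect algebra fulfilling the condition (W+). Then $E$ can be covered by Archimedean MV-algebras which form blocks; that is, $E$ is the union of its blocks, and every block of $E$ is lattice ordered and is an Archimedean MV-algebra.
   Context: An effect algebra is a partial algebra $(E;\oplus,0,1)$ with $0\neq 1$ and a partial binary operation $\oplus$ such that for all $x,y,z\in E$: (1) $x\oplus y=y\oplus x$ if $x\oplus y$ is defined; (2) $(x\oplus y)\oplus z=x\oplus(y\oplus z)$ if one side is defined; (3) for every $x$ there is a unique $y$ (denoted $x'$) with $x\oplus y=1$; (4) if $1\oplus x$ is defined then $x=0$. One writes $x\le y$ and $y\ominus x=z$ iff $x\oplus z$ is defined and equals $y$; $\le$ is a partial order. A sub-effect algebra of $E$ is a subset $Q\subseteq E$ with $1\in Q$ such that whenever $x\oplus y=z$ in $E$ and two of $x,y,z$ lie in $Q$, all three lie in $Q$; it is an effect algebra with the inherited operation. $E$ satisfies the Riesz decomposition property if $u\le v_1\oplus v_2$ implies $u=u_1\oplus u_2$ for some $u_1\le v_1$, $u_2\le v_2$. $E$ is homogeneous if $u\le v_1\oplus v_2\le u'$ implies $u=u_1\oplus u_2$ for some $u_1\le v_1$, $u_2\le v_2$. A block of a homogeneous effect algebra $E$ is a maximal sub-effect algebra of $E$ with the Riesz decomposition property. $E$ is Archimedean if for every nonzero $x\in E$ there is a greatest positive integer $n$ such that $nx=x\oplus\dots\oplus x$ ($n$ times) exists. A subset $A\subseteq E$ is orthogonal if the sum $\bigoplus K$ exists for every finite $K\subseteq A$ (with $\bigoplus\emptyset=0$),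 and then $A^\oplus=\{\bigoplus K\mid K\subseteq A \text{ finite}\}$. $E$ fulfills the condition (W+) if for each orthogonal subset $A\subseteq E$ and each two upper bounds $u,v$ of $A^\oplus$ there exists an upper bound $w$ of $A^\oplus$ with $w\le u$ and $w\le v$. An effect algebra is said to be an MV-algebra (an MV-effect algebra) if it is lattice ordered and has the Riesz decomposition property; it is then an MV-algebra under the total operation $x\boxplus y=x\oplus(x'\wedge y)$ and negation $x\mapsto x'$. It is called Archimedean if it is Archimedean as an effect algebra. -}

module Defs where

open import Data.Irrelevant using ([_]; zipWith)
open import Data.List.Base using (List; []; _∷_; replicate)
open import Data.List.Relation.Unary.All using (All)
open import Data.List.Relation.Unary.Unique.Propositional using (Unique)
open import Data.Nat.Base as ℕ using (ℕ)
open import Data.Product using (_×_; _,_; ∃-syntax; ∃!; Σ-syntax; proj₁; proj₂)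
open import Data.Refinement.Base using (Refinement; value; proof; _,_)
open import Data.Refinement.Properties using (value-injective)
open import Function.Bundles using (_⇔_; mk⇔; Equivalence)
open import Level using (Level; suc)
open import Relation.Binary.Core using (Rel)
open import Relation.Binary.Lattice.Structures using (IsLattice)
open import Relation.Binary.PropositionalEquality
  using (_≡_; _≢_; cong; subst)
open import Relation.Unary using (Pred; _∈_; _⊆_)

private
  variable
    ℓ : Level

-- The partial operation is given by its graph: x ⊕ y ≔ z reads
-- "x ⊕ y is defined and equals z".

record EffectAlgebra (ℓ : Level) : Set (suc ℓ) where
  infix 4 _⊕_≔_ _≤_
  infix 9 _′
  field
    Carrier    : Set ℓ
    _⊕_≔_      : Carrier → Carrier → Carrier → Set ℓ
    0#         : Carrier
    1#         : Carrier
    functional : ∀ {x y z₁ z₂} → x ⊕ y ≔ z₁ → x ⊕ y ≔ z₂ → z₁ ≡ z₂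
    0≢1        : 0# ≢ 1#
    comm       : ∀ {x y z} → x ⊕ y ≔ z → y ⊕ x ≔ z
    assoc      : ∀ {x y z w} → (∃[ u ] x ⊕ y ≔ u × u ⊕ z ≔ w) ⇔
                               (∃[ v ] y ⊕ z ≔ v × x ⊕ v ≔ w)
    complement : ∀ x → ∃! _≡_ λ y → x ⊕ y ≔ 1#
    zero-one   : ∀ {x} → (∃[ z ] 1# ⊕ x ≔ z) → x ≡ 0#

  _′ : Carrier → Carrier
  x ′ = proj₁ (complement x)

  _≤_ : Rel Carrier ℓ
  x ≤ y = ∃[ z ] x ⊕ z ≔ y

  1⊕0≔1 : 1# ⊕ 0# ≔ 1#
  1⊕0≔1 with complement 1#
  ... | y , 1⊕y≔1 , _ = subst (λ t → 1# ⊕ t ≔ 1#) (zero-one (1# , 1⊕y≔1)) 1⊕y≔1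

  -- The definedness and value of a finite sum depend neither on
  -- bracketing nor on order, so lists summed from the right suffice.
  data ⨁_≔_ : List Carrier → Carrier → Set ℓ where
    []  : ⨁ [] ≔ 0#
    _∷_ : ∀ {x xs s z} → x ⊕ s ≔ z → ⨁ xs ≔ s → ⨁ (x ∷ xs) ≔ z

module _ (E : EffectAlgebra ℓ) where
  open EffectAlgebra E

  RieszDecomposition : Set ℓ
  RieszDecomposition = ∀ {u v₁ v₂ v} → v₁ ⊕ v₂ ≔ v → u ≤ v →
    ∃[ u₁ ] ∃[ u₂ ] u₁ ≤ v₁ × u₂ ≤ v₂ × u₁ ⊕ u₂ ≔ u

  Homogeneous : Set ℓ
  Homogeneous = ∀ {u v₁ v₂ v} → v₁ ⊕ v₂ ≔ v → u ≤ v → v ≤ u ′ →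
    ∃[ u₁ ] ∃[ u₂ ] u₁ ≤ v₁ × u₂ ≤ v₂ × u₁ ⊕ u₂ ≔ u

  MultipleExists : ℕ → Carrier → Set ℓ
  MultipleExists n x = ∃[ z ] ⨁ replicate n x ≔ z

  Archimedean : Set ℓ
  Archimedean = ∀ x → x ≢ 0# →
    ∃[ n ] 1 ℕ.≤ n × MultipleExists n x × (∀ m → MultipleExists m x → m ℕ.≤ n)

  LatticeOrdered : Set ℓ
  LatticeOrdered = ∃[ join ] ∃[ meet ] IsLattice _≡_ _≤_ join meet

  IsMV : Set ℓ
  IsMV = LatticeOrdered × RieszDecomposition

  -- Finite subsets are duplicate-free lists.
  _FiniteSubsetOf_ : List Carrier → Pred Carrier ℓ → Set ℓ
  K FiniteSubsetOf A = Unique K × All A K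

  Orthogonal : Pred Carrier ℓ → Set ℓ
  Orthogonal A = ∀ K → K FiniteSubsetOf A → ∃[ z ] ⨁ K ≔ z

  _^⊕ : Pred Carrier ℓ → Pred Carrier ℓ
  (A ^⊕) z = ∃[ K ] K FiniteSubsetOf A × ⨁ K ≔ z

  UpperBound : Pred Carrier ℓ → Pred Carrier ℓ
  UpperBound A u = ∀ {x} → x ∈ A → x ≤ u

  W+ : Set (suc ℓ)
  W+ = ∀ (A : Pred Carrier ℓ) → Orthogonal A →
    ∀ {u v} → UpperBound (A ^⊕) u → UpperBound (A ^⊕) v →
    ∃[ w ] UpperBound (A ^⊕) w × w ≤ u × w ≤ v

  record IsSubEffectAlgebra (Q : Pred Carrier ℓ) : Set ℓ where
    field
      1∈  : 1# ∈ Q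
      xy∈ : ∀ {x y z} → x ⊕ y ≔ z → x ∈ Q → y ∈ Q → z ∈ Q
      xz∈ : ∀ {x y z} → x ⊕ y ≔ z → x ∈ Q → z ∈ Q → y ∈ Q
      yz∈ : ∀ {x y z} → x ⊕ y ≔ z → y ∈ Q → z ∈ Q → x ∈ Q

    0∈ : 0# ∈ Q
    0∈ = xz∈ 1⊕0≔1 1∈ 1∈

-- Membership proofs are irrelevant in the carrier of the subalgebra, so
-- that its elements are equal exactly when they are equal in E.

subEffectAlgebra : (E : EffectAlgebra ℓ) (Q : Pred (EffectAlgebra.Carrier E) ℓ) →
                   IsSubEffectAlgebra E Q → EffectAlgebra ℓ
subEffectAlgebra E Q sub = record
  { Carrier    = Refinement Carrier Q
  ; _⊕_≔_      = λ x y z → value x ⊕ value y ≔ value z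
  ; 0#         = 0# , [ 0∈ ]
  ; 1#         = 1# , [ 1∈ ]
  ; functional = λ p q → value-injective (functional p q)
  ; 0≢1        = λ eq → 0≢1 (cong value eq)
  ; comm       = comm
  ; assoc      = λ {x} {y} {z} {w} → mk⇔
      (λ (u , p , q) → let v , r , s = Equivalence.to assoc (value u , p , q)
                       in (v , zipWith (xy∈ r) (proof y) (proof z)) , r , s)
      (λ (v , p , q) → let u , r , s = Equivalence.from assoc (value v , p , q)
                       in (u , zipWith (xy∈ r) (proof x) (proof y)) , r , s)
  ; complement = λ x → let y , p , unique = complement (value x)
                       in (y , zipWith (xz∈ p) (proof x) [ 1∈ ]) , p ,
                          λ q → value-injective (unique q)
  ; zero-one   = λ (z , p) → value-injective (zero-one (value z , p))
  }
  where
  open EffectAlgebra E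
  open IsSubEffectAlgebra sub

module _ (E : EffectAlgebra ℓ) where
  open EffectAlgebra E

  record IsBlock (Q : Pred Carrier ℓ) : Set (suc ℓ) where
    field
      isSubEffectAlgebra : IsSubEffectAlgebra E Q
      riesz   : RieszDecomposition (subEffectAlgebra E Q isSubEffectAlgebra)
      maximal : ∀ (R : Pred Carrier ℓ) (sub : IsSubEffectAlgebra E R) →
                RieszDecomposition (subEffectAlgebra E R sub) → Q ⊆ R → R ⊆ Q

    block : EffectAlgebra ℓ
    block = subEffectAlgebra E Q isSubEffectAlgebra

  UnionOfBlocks : Set (suc ℓ)
  UnionOfBlocks = ∀ x → Σ[ Q ∈ Pred Carrier ℓ ] IsBlock Q × x ∈ Q

-- A partition of 1 is enlarged by splitting an entry b into h and b ⊖ h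
-- whenever h ⊕ b is defined. By homogeneity the partitions so obtained are
-- directed under refinement, and the sums of their entries form a sub-effect
-- algebra with the Riesz decomposition property. Starting from {x, x′}, Zorn's
-- lemma gives a block through x; starting from the partitions inside a block
-- Q, maximality gives y ∈ Q whenever y ≤ x ∈ Q and x ⊕ y is defined.
--
-- For r orthogonal to q there is, by (W+) and Archimedeanity, a common lower
-- bound m such that m ⊕ d is a common lower bound only for d = 0: m is an
-- interpolated bound of a maximal orthogonal set. If r and q lie in a block,
-- so does m, since m ≤ r and m ≤ q ≤ r′. Applied to r = v ⊖ p and q, where
-- u = p ⊕ q with p ≤ v and q ≤ v′, this makes p ⊕ m the meet of u and v in the
-- block, by Riesz interpolation.
--
-- The partial operation is made total by adjoining an absorbing element for
-- undefined sums.

module Submission where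

open import Defs
open import Axiom.ExcludedMiddle using (ExcludedMiddle)
open import Axiom.Extensionality.Propositional using (Extensionality)
open import Algebra.Bundles using (CommutativeMonoid)
open import Algebra.Structures using (IsCommutativeMonoid)
open import Algebra.Structures.Biased using (isCommutativeMonoidˡ)
open import Data.Bool.Base using (Bool; true; false; T; not; _∧_; _∨_; if_then_else_)
open import Data.Bool.Properties using (T-≡; ∧-comm; ∧-zeroʳ; ∧-identityʳ)
open import Data.Empty using (⊥; ⊥-elim)
open import Data.Irrelevant using ([_])
open import Data.List.Base using (List; []; _∷_; _++_; map; length; replicate; foldr)
open import Data.List.Relation.Binary.Permutation.Propositional as Perm using (_↭_; ↭-sym)
open import Data.List.Relation.Binary.Permutation.Propositional.Properties using (shift)
open import Data.List.Properties using (++-identityʳ; map-replicate)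
open import Data.List.Relation.Unary.All as All using (All; []; _∷_)
open import Data.List.Relation.Unary.AllPairs using ([]; _∷_)
open import Data.List.Relation.Unary.Unique.Propositional using (Unique)
import Data.List.Relation.Unary.All.Properties as All
import Data.List.Relation.Unary.Unique.Propositional.Properties as Unique
open import Data.Maybe.Base using (Maybe; just; nothing)
open import Data.Maybe.Properties using (just-injective)
open import Data.Nat.Base as ℕ using (ℕ; zero; suc; s≤s⁻¹)
open import Data.Nat.Properties using (≤∧≢⇒<; 1+n≰n)
open import Data.Product.Base using (_×_; _,_; Σ-syntax; ∃-syntax; proj₁; proj₂)
open import Data.Refinement.Base using (value; _,_)
open import Data.Refinement.Properties using (value-injective)
open import Data.Sum.Base using (_⊎_; inj₁; inj₂)
open import Function.Base using (_∘_; id; const; case_of_)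
open import Function.Bundles using (Equivalence)
open import Level using (Level; Lift; lift; lower; _⊔_) renaming (suc to lsuc)
open import Relation.Binary.PropositionalEquality
  using (_≡_; _≢_; refl; sym; trans; cong; cong₂; subst; isEquivalence; module ≡-Reasoning)
open import Relation.Binary.Structures using (IsPartialOrder)
open import Relation.Nullary using (¬_; Dec; yes; no; contradiction)
open import Relation.Nullary.Decidable using (⌊_⌋; toWitness; fromWitness; decidable-stable; recompute)
open import Relation.Unary using (Pred)

private
  variable
    a p q ℓ : Level

-- Boolean-valued subsets and Zorn's lemma.

module Subsets (em : ∀ {a} → ExcludedMiddle a) {A : Set a} where

  infix 4 _∈_ _⊆_

  _∈_ : A → (A → Bool) → Set
  x ∈ U = T (U x)

  _⊆_ : (U V : A → Bool) → Set a
  U ⊆ V = ∀ {x} → x ∈ U → x ∈ V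

  ⟪_⟫ : Pred A p → A → Bool
  ⟪ P ⟫ x = ⌊ em {P = P x} ⌋

  ∈⁺ : (P : Pred A p) → ∀ {x} → P x → x ∈ ⟪ P ⟫
  ∈⁺ _ = fromWitness

  ∈⁻ : (P : Pred A p) → ∀ {x} → x ∈ ⟪ P ⟫ → P x
  ∈⁻ _ = toWitness

  -- Satisfied by every property that is checked on finitely many elements at a time.
  Local : Pred (A → Bool) p → Set (a ⊔ p)
  Local P = ∀ U → (∀ xs → All (_∈ U) xs → ∃[ V ] P V × V ⊆ U × All (_∈ V) xs) → P U

  Maximal : Pred (A → Bool) p → Pred (A → Bool) (a ⊔ p)
  Maximal P U = P U × (∀ V → P V → U ⊆ V → V ⊆ U)

-- Excluded middle for all types selects witnesses, hence gives a successor
-- function; extensionality makes the tower below it a chain.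
module Zorn (em : ∀ {a} → ExcludedMiddle a) (ext : ∀ {a b} → Extensionality a b)
  {A : Set a} (P : Pred (A → Bool) p) (local : Subsets.Local em P)
  (U₀ : A → Bool) (PU₀ : P U₀) where

  open Subsets em {A = A}

  private
    ⊆-antisym : ∀ {U V} → U ⊆ V → V ⊆ U → U ≡ V
    ⊆-antisym {U} {V} U⊆V V⊆U = ext λ x → lemma (U x) (V x) U⊆V V⊆U
      where
      lemma : ∀ b c → (T b → T c) → (T c → T b) → b ≡ c
      lemma false false _ _ = refl
      lemma false true  _ g = ⊥-elim (g _)
      lemma true  false f _ = ⊥-elim (f _)
      lemma true  true  _ _ = refl

    Larger : (A → Bool) → Set _
    Larger U = ∃[ V ] P V × U ⊆ V × ¬ V ⊆ U

    next-of : ∀ {U} → Dec (Larger U) → A → Bool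
    next-of (yes (V , _)) = V
    next-of {U} (no _)    = U

    next : (A → Bool) → A → Bool
    next U = next-of (em {P = Larger U})

    ⊆-next : ∀ U → U ⊆ next U
    ⊆-next U with em {P = Larger U}
    ... | yes (_ , _ , U⊆V , _) = U⊆V
    ... | no _ = id

    next-P : ∀ {U} → P U → P (next U)
    next-P {U} PU with em {P = Larger U}
    ... | yes (_ , PV , _) = PV
    ... | no _ = PU

    next-maximal : ∀ {U} → P U → next U ⊆ U → Maximal P U
    next-maximal {U} PU s with em {P = Larger U}
    ... | yes (_ , _ , _ , V⊈U) = ⊥-elim (V⊈U s)
    ... | no ¬larger = PU , λ V PV U⊆V →
      decidable-stable em λ V⊈U → ¬larger (V , PV , U⊆V , V⊈U)

    InSome : ((A → Bool) → Bool) → Pred A a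
    InSome F x = ∃[ U ] T (F U) × x ∈ U

    ⋃ : ((A → Bool) → Bool) → A → Bool
    ⋃ F = ⟪ InSome F ⟫

    -- The tower of the Bourbaki-Witt argument. Families are Boolean-valued, which keeps `Tower` in
    -- the universe of `A`.
    data Tower : (A → Bool) → Set a where
      base : Tower U₀
      step : ∀ {U} → Tower U → Tower (next U)
      sup  : ∀ F → (∃[ U ] T (F U)) → (∀ U → T (F U) → Tower U) → Tower (⋃ F)

    member-⊆-⋃ : ∀ F {U} → T (F U) → U ⊆ ⋃ F
    member-⊆-⋃ F FU x∈U = ∈⁺ (InSome F) (_ , FU , x∈U)

    ⋃-⊆ : ∀ F {V} → (∀ U → T (F U) → U ⊆ V) → ⋃ F ⊆ V
    ⋃-⊆ F h x∈ = let U , FU , x∈U = ∈⁻ (InSome F) x∈ in h U FU x∈U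

    U₀⊆ : ∀ {U} → Tower U → U₀ ⊆ U
    U₀⊆ base = id
    U₀⊆ (step t) = ⊆-next _ ∘ U₀⊆ t
    U₀⊆ (sup F (U , FU) t) = member-⊆-⋃ F FU ∘ U₀⊆ (t U FU)

    Extreme : (A → Bool) → Set a
    Extreme C = ∀ {V} → Tower V → V ⊆ C → ¬ C ⊆ V → next V ⊆ C

    -- Induction on the tower. In the successor step a `V` strictly below `C` keeps its successor
    -- below `C` by extremeness, and a `V` equal to `C` has successor `next C`.
    extreme-splits : ∀ {C V} → Extreme C → Tower C → Tower V → V ⊆ C ⊎ next C ⊆ V
    extreme-splits e tC base = inj₁ (U₀⊆ tC)
    extreme-splits {C} e tC (step {V} tV) with extreme-splits e tC tV
    ... | inj₂ nC⊆V = inj₂ (⊆-next V ∘ nC⊆V)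
    ... | inj₁ V⊆C with em {P = C ⊆ V}
    ...   | no C⊈V = inj₁ (e tV V⊆C C⊈V)
    -- `next` need not be monotone, so mutual inclusion is first turned into equality.
    ...   | yes C⊆V with refl ← ⊆-antisym {C} {V} C⊆V V⊆C = inj₂ id
    extreme-splits {C} e tC (sup F _ t) with em {P = ∃[ V ] T (F V) × next C ⊆ V}
    ... | yes (V , FV , nC⊆V) = inj₂ (member-⊆-⋃ F FV ∘ nC⊆V)
    ... | no none = inj₁ (⋃-⊆ F λ V FV → case extreme-splits e tC (t V FV) of λ where
      (inj₁ V⊆C)  → V⊆C
      (inj₂ nC⊆V) → ⊥-elim (none (V , FV , nC⊆V)))

    -- The successor and union cases use `extreme-splits` at an earlier member, extreme by
    -- induction; a union strictly above `V` has a member above `V`.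
    extreme : ∀ {C} → Tower C → Extreme C
    extreme base tV _ U₀⊈V = ⊥-elim (U₀⊈V (U₀⊆ tV))
    extreme (step {C} tC) {V} tV V⊆nC nC⊈V with extreme-splits (extreme tC) tC tV
    ... | inj₂ nC⊆V = ⊥-elim (nC⊈V nC⊆V)
    ... | inj₁ V⊆C with em {P = C ⊆ V}
    ...   | no C⊈V = ⊆-next C ∘ extreme tC tV V⊆C C⊈V
    ...   | yes C⊆V with refl ← ⊆-antisym {C} {V} C⊆V V⊆C = id
    extreme (sup F ne t) {V} tV V⊆⋃ ⋃⊈V with em {P = ∃[ C ] Σ[ FC ∈ T (F C) ] V ⊆ C}
    ... | no none = ⊥-elim (⋃⊈V (⋃-⊆ F λ C FC →
      case extreme-splits (extreme (t C FC)) (t C FC) tV of λ where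
        (inj₁ V⊆C)  → ⊥-elim (none (C , FC , V⊆C))
        (inj₂ nC⊆V) → nC⊆V ∘ ⊆-next C))
    ... | yes (C , FC , V⊆C) with em {P = C ⊆ V}
    ...   | no C⊈V = member-⊆-⋃ F FC ∘ extreme (t C FC) tV V⊆C C⊈V
    ...   | yes C⊆V with refl ← ⊆-antisym {C} {V} C⊆V V⊆C =
      case extreme-splits (extreme (t C FC)) tV (sup F ne t) of λ where
        (inj₁ ⋃⊆C)  → ⊥-elim (⋃⊈V ⋃⊆C)
        (inj₂ nC⊆⋃) → nC⊆⋃

    chain : ∀ {U V} → Tower U → Tower V → U ⊆ V ⊎ V ⊆ U
    chain {U} tU tV with extreme-splits (extreme tU) tU tV
    ... | inj₁ V⊆U  = inj₂ V⊆U
    ... | inj₂ nU⊆V = inj₁ (nU⊆V ∘ ⊆-next U)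

    -- Of two members of a chain the larger serves for both. With `local` this carries `P` through
    -- unions.
    common-member : ∀ F → (∃[ U ] T (F U)) → (∀ U → T (F U) → Tower U) →
                    ∀ xs → All (_∈ ⋃ F) xs → ∃[ V ] T (F V) × All (_∈ V) xs
    common-member F (U , FU) t [] [] = U , FU , []
    common-member F ne t (x ∷ xs) (x∈ ∷ xs∈)
      with common-member F ne t xs xs∈ | ∈⁻ (InSome F) x∈
    ... | V , FV , xs∈V | U , FU , x∈U with chain (t U FU) (t V FV)
    ...   | inj₁ U⊆V = V , FV , U⊆V x∈U ∷ xs∈V
    ...   | inj₂ V⊆U = U , FU , x∈U ∷ All.map V⊆U xs∈V

    tower-P : ∀ {U} → Tower U → P U
    tower-P base = PU₀
    tower-P (step t) = next-P (tower-P t)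
    tower-P (sup F ne t) = local (⋃ F) λ xs xs∈ →
      let V , FV , xs∈V = common-member F ne t xs xs∈
      in V , tower-P (t V FV) , member-⊆-⋃ F FV , xs∈V

    all-towers : (A → Bool) → Bool
    all-towers U = ⌊ em {P = Tower U} ⌋

    top : Tower (⋃ all-towers)
    top = sup all-towers (U₀ , fromWitness base) λ _ → toWitness

  maximal : ∃[ U ] Maximal P U × U₀ ⊆ U
  maximal = ⋃ all-towers
          -- The successor of the top is again in the tower, hence included in the top.
          , next-maximal (tower-P top) (member-⊆-⋃ all-towers (fromWitness (step top)))
          , U₀⊆ top

-- Effect algebras as total commutative monoids.

record EffectMonoid (ℓ : Level) : Set (lsuc ℓ) where
  infixr 7 _∙_
  field
    M   : Set ℓ
    _∙_ : M → M → M
    ε ⊤ : M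
    isCommutativeMonoid : IsCommutativeMonoid _≡_ _∙_ ε

  infix 4 ↓_ _≼_

  -- The summands of `⊤` are the defined elements; any other element stands for an undefined sum.
  ↓_ : M → Set ℓ
  ↓ x = ∃[ y ] x ∙ y ≡ ⊤

  _≼_ : M → M → Set ℓ
  x ≼ y = ∃[ z ] x ∙ z ≡ y

  field
    cancel  : ∀ x {y z} → ↓ x ∙ y → x ∙ y ≡ x ∙ z → y ≡ z
    ⊤-isTop : ∀ {x} → ↓ ⊤ ∙ x → x ≡ ε

  commutativeMonoid : CommutativeMonoid ℓ ℓ
  commutativeMonoid = record { isCommutativeMonoid = isCommutativeMonoid }

  open CommutativeMonoid commutativeMonoid public
    using (assoc; comm; identityˡ; identityʳ; commutativeSemigroup; rawMonoid)

module EffectMonoidProperties (S : EffectMonoid ℓ) where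

  open EffectMonoid S
  open import Algebra.Properties.CommutativeSemigroup commutativeSemigroup public
    using (interchange; x∙yz≈y∙xz)
  open import Algebra.Solver.CommutativeMonoid commutativeMonoid public
    using (solve; _⊜_; _⊕_)

  private
    variable
      x y z w : M

  ↓⊤ : ↓ ⊤
  ↓⊤ = ε , identityʳ ⊤

  ↓-≼ : x ≼ y → ↓ y → ↓ x
  ↓-≼ {x} (z , refl) (w , e) = z ∙ w , trans (sym (assoc x z w)) e

  ≼-refl : x ≼ x
  ≼-refl = ε , identityʳ _

  ≼-reflexive : x ≡ y → x ≼ y
  ≼-reflexive refl = ≼-refl

  ≼-trans : x ≼ y → y ≼ z → x ≼ z
  ≼-trans (u , refl) (v , refl) = u ∙ v , sym (assoc _ u v)

  x≼x∙y : x ≼ x ∙ y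
  x≼x∙y = _ , refl

  y≼x∙y : y ≼ x ∙ y
  y≼x∙y = _ , comm _ _

  ε≼ : ε ≼ x
  ε≼ = _ , identityˡ _

  ∙-mono : x ≼ y → z ≼ w → x ∙ z ≼ y ∙ w
  ∙-mono {x} {z = z} (u , refl) (v , refl) = u ∙ v , interchange x z u v

  ∙-monoʳ : ∀ x → y ≼ z → x ∙ y ≼ x ∙ z
  ∙-monoʳ x = ∙-mono ≼-refl

  ∙-cancel-≼ : ∀ x → ↓ x ∙ z → x ∙ y ≼ x ∙ z → y ≼ z
  ∙-cancel-≼ x d (u , e) = u , sym (cancel x d (trans (sym e) (assoc x _ u)))

  ↓-comm : ↓ x ∙ y → ↓ y ∙ x
  ↓-comm = subst ↓_ (comm _ _)

  positive : x ∙ y ≡ ε → x ≡ ε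
  positive {x} {y} e = ⊤-isTop (y , (begin
    (⊤ ∙ x) ∙ y  ≡⟨ assoc ⊤ x y ⟩
    ⊤ ∙ (x ∙ y)  ≡⟨ cong (⊤ ∙_) e ⟩
    ⊤ ∙ ε        ≡⟨ identityʳ ⊤ ⟩
    ⊤            ∎))
    where open ≡-Reasoning

  ≼ε : x ≼ ε → x ≡ ε
  ≼ε (_ , e) = positive e

  ≼-antisym : ↓ y → x ≼ y → y ≼ x → x ≡ y
  ≼-antisym {y} {x} d (u , refl) (v , e) =
    sym (trans (cong (x ∙_) (positive {y = v} (cancel x d′ e′))) (identityʳ x))
    where
    e′ : x ∙ (u ∙ v) ≡ x ∙ ε
    e′ = trans (sym (assoc x u v)) (trans e (sym (identityʳ x)))
    d′ : ↓ x ∙ (u ∙ v)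
    d′ = subst ↓_ (trans (sym e) (assoc x u v)) (↓-≼ (u , refl) d)

-- Weighted lists and their refinement.

-- A list is read as a finitely supported measure on subsets of ℕ, a list Z
-- refining Y when the measure of Y is an image of that of Z.
module Measures (ext : ∀ {a b} → Extensionality a b) (S : EffectMonoid ℓ) where

  open EffectMonoid S
  open EffectMonoidProperties S

  infix 8 _⊙_

  _⊙_ : Bool → M → M
  b ⊙ x = if b then x else ε

  μ : (ℕ → Bool) → List M → M
  μ p []      = ε
  μ p (z ∷ Z) = p 0 ⊙ z ∙ μ (p ∘ suc) Z

  infix 4 _≽_

  -- `place` sends the index of an entry of `Z` to the index of the entry of `Y` that it is part of.
  record _≽_ (Z Y : List M) : Set ℓ where
    constructor _,_
    field
      place : ℕ → ℕ
      image : ∀ p → μ p Y ≡ μ (p ∘ place) Z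

  ≽-refl : ∀ {Z} → Z ≽ Z
  ≽-refl = id , λ p → refl

  ≽-trans : ∀ {X Y Z} → X ≽ Y → Y ≽ Z → X ≽ Z
  ≽-trans (g , f) (g′ , f′) = (g′ ∘ g) , λ p → trans (f′ p) (f (p ∘ g′))

  μ-cong : ∀ {p q} Z → (∀ n → p n ≡ q n) → μ p Z ≡ μ q Z
  μ-cong Z e = cong (λ p → μ p Z) (ext e)

  ⊙-distrib : ∀ b x y → b ⊙ (x ∙ y) ≡ b ⊙ x ∙ b ⊙ y
  ⊙-distrib false x y = sym (identityˡ ε)
  ⊙-distrib true  x y = refl

  ⊙-ε : ∀ b → b ⊙ ε ≡ ε
  ⊙-ε false = refl
  ⊙-ε true  = refl

  ⊙-split : ∀ b c x → b ⊙ x ≡ (b ∧ c) ⊙ x ∙ (b ∧ not c) ⊙ x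
  ⊙-split false c     x = sym (identityˡ ε)
  ⊙-split true  false x = sym (identityˡ x)
  ⊙-split true  true  x = sym (identityʳ x)

  μ-split : ∀ p q Z → μ p Z ≡ μ (λ n → p n ∧ q n) Z ∙ μ (λ n → p n ∧ not (q n)) Z
  μ-split p q []      = sym (identityˡ ε)
  μ-split p q (z ∷ Z) = trans
    (cong₂ _∙_ (⊙-split (p 0) (q 0) z) (μ-split (p ∘ suc) (q ∘ suc) Z))
    (interchange _ _ _ _)

  μ-false : ∀ Z → μ (const false) Z ≡ ε
  μ-false []      = refl
  μ-false (z ∷ Z) = trans (identityˡ _) (μ-false Z)

  μ-≼ : ∀ p Z → μ p Z ≼ μ (const true) Z
  μ-≼ p Z = _ , sym (μ-split (const true) p Z)

  atZero : ℕ → Bool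
  atZero zero    = true
  atZero (suc _) = false

  μ-atZero : ∀ z Z → μ atZero (z ∷ Z) ≡ z
  μ-atZero z Z = trans (cong (z ∙_) (μ-false Z)) (identityʳ z)

  ↭⇒≽ : ∀ {X Y} → X ↭ Y → X ≽ Y
  ↭⇒≽ Perm.refl = ≽-refl
  ↭⇒≽ (Perm.prep x X↭Y) = let g , f = ↭⇒≽ X↭Y in
    (λ { zero → zero ; (suc n) → suc (g n) }) , λ p → cong (_ ∙_) (f (p ∘ suc))
  ↭⇒≽ (Perm.swap x y X↭Y) = let g , f = ↭⇒≽ X↭Y in
    (λ { zero → 1 ; (suc zero) → zero ; (suc (suc n)) → suc (suc (g n)) }) , λ p →
    trans (x∙yz≈y∙xz _ _ _) (cong (λ t → _ ∙ _ ∙ t) (f (p ∘ suc ∘ suc)))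
  ↭⇒≽ (Perm.trans X↭Y Y↭Z) = ≽-trans (↭⇒≽ X↭Y) (↭⇒≽ Y↭Z)

  merge flatten : List (M × M) → List M
  merge = map λ (h , r) → h ∙ r
  flatten []             = []
  flatten ((h , r) ∷ HR) = h ∷ r ∷ flatten HR

  -- `flatten` puts first components at even and second ones at odd positions; masks and placements
  -- are built to match.
  interleave : {A : Set a} → (ℕ → A) → (ℕ → A) → ℕ → A
  interleave f g zero          = f 0
  interleave f g (suc zero)    = g 0
  interleave f g (suc (suc n)) = interleave (f ∘ suc) (g ∘ suc) n

  ∘-interleave : {A B : Set} (k : A → B) (f g : ℕ → A) →
                 ∀ n → interleave (k ∘ f) (k ∘ g) n ≡ k (interleave f g n)
  ∘-interleave k f g zero          = refl
  ∘-interleave k f g (suc zero)    = refl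
  ∘-interleave k f g (suc (suc n)) = ∘-interleave k (f ∘ suc) (g ∘ suc) n

  μ-merge : ∀ p HR → μ p (merge HR) ≡ μ p (map proj₁ HR) ∙ μ p (map proj₂ HR)
  μ-merge p []             = sym (identityˡ ε)
  μ-merge p ((h , r) ∷ HR) = trans
    (cong₂ _∙_ (⊙-distrib (p 0) h r) (μ-merge (p ∘ suc) HR))
    (interchange _ _ _ _)

  μ-flatten : ∀ p q HR →
    μ (interleave p q) (flatten HR) ≡ μ p (map proj₁ HR) ∙ μ q (map proj₂ HR)
  μ-flatten p q []             = sym (identityˡ ε)
  μ-flatten p q ((h , r) ∷ HR) = trans
    (cong (λ t → _ ∙ _ ∙ t) (μ-flatten (p ∘ suc) (q ∘ suc) HR))
    (solve 4 (λ h r H R → h ⊕ (r ⊕ (H ⊕ R)) ⊜ (h ⊕ H) ⊕ (r ⊕ R)) refl _ _ _ _)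

  half : ℕ → ℕ
  half = interleave id id

  flatten-≽ : ∀ HR → flatten HR ≽ merge HR
  flatten-≽ HR = half , λ p → begin
    μ p (merge HR)                             ≡⟨ μ-merge p HR ⟩
    μ p (map proj₁ HR) ∙ μ p (map proj₂ HR)    ≡⟨ μ-flatten p p HR ⟨
    μ (interleave p p) (flatten HR)            ≡⟨ μ-cong (flatten HR) (∘-interleave p id id) ⟩
    μ (p ∘ half) (flatten HR)                  ∎
    where open ≡-Reasoning

-- Partitions of the unit and their common refinements.

module Partitions (ext : ∀ {a b} → Extensionality a b) (S : EffectMonoid ℓ)
  (C : Pred (List (EffectMonoid.M S)) ℓ)
  (C-total : ∀ {Z} → C Z → Measures.μ ext S (const true) Z ≡ EffectMonoid.⊤ S)
  (G : (h b : EffectMonoid.M S) → Set ℓ) where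

  open EffectMonoid S
  open EffectMonoidProperties S
  open Measures ext S

  -- `C` holds the partitions to start from, and `G h b` is the licence to split `h` off an entry
  -- `b`. Splitting the head is enough, since `coarsen` also permutes.
  data K : Pred (List M) ℓ where
    base    : ∀ {Z} → C Z → K Z
    coarsen : ∀ {Y Z} → K Z → Z ≽ Y → K Y
    split   : ∀ {h r Y} → G h (h ∙ r) → K (h ∙ r ∷ Y) → K (h ∷ r ∷ Y)

  K-total : ∀ {Z} → K Z → μ (const true) Z ≡ ⊤
  K-total (base c)                = C-total c
  K-total (coarsen k (_ , im))    = trans (im (const true)) (K-total k)
  K-total (split {h} {r} {Y} _ k) = trans (sym (assoc h r _)) (K-total k)

  K-defined : ∀ {Z} → K Z → ∀ p → ↓ μ p Z
  K-defined {Z} k p = ↓-≼ (μ-≼ p Z) (subst ↓_ (sym (K-total k)) ↓⊤)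

  All-split : List (M × M) → Set ℓ
  All-split = All λ (h , r) → G h (h ∙ r)

  -- Only the head can be split, so each entry is carried behind the others and fetched back once
  -- they are split.
  flatten-K : ∀ {HR} Y → All-split HR → K (merge HR ++ Y) → K (flatten HR ++ Y)
  flatten-K Y [] k = k
  flatten-K {(h , r) ∷ HR} Y (g ∷ gs) k =
    split g (coarsen (flatten-K (h ∙ r ∷ Y) gs (coarsen k (↭⇒≽ (↭-sym (shift _ (merge HR) Y)))))
                     (↭⇒≽ (shift _ (flatten HR) Y)))

  Common : (X Y : List M) → Set ℓ
  Common X Y = ∃[ Z ] K Z × Z ≽ X × Z ≽ Y

  Common-sym : ∀ {X Y} → Common X Y → Common Y X
  Common-sym (Z , kZ , ZX , ZY) = Z , kZ , ZY , ZX

  module Refinable (W : Pred M ℓ) (K-W : ∀ {Z} → K Z → ∀ p → W (μ p Z))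
    (W⇒↓ : ∀ {z} → W z → ↓ z) (G-ε : ∀ {z} → W z → G ε z)
    (interpolate : ∀ {h x y} → W x → W y → W (x ∙ y) → G h (x ∙ y) → h ≼ x ∙ y →
      ∃[ h₁ ] ∃[ h₂ ] h₁ ≼ x × h₂ ≼ y × h₁ ∙ h₂ ≡ h × G h₁ x × G h₂ y)
    (directed₀ : ∀ {X Y} → C X → C Y → ∃[ Z ] C Z × Z ≽ X × Z ≽ Y)
    where

    -- The parts of h taken from the entries in q vanish outside q.
    Carries : (ℕ → Bool) → M → List M → Set ℓ
    Carries q h H = ∀ p c → (∀ j → T (q j) → p j ≡ c) → μ p H ≡ c ⊙ h

    W-head : ∀ {z} Z → (∀ p → W (μ p (z ∷ Z))) → W z
    W-head {z} Z w = subst W (μ-atZero z Z) (w atZero)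

    W-tail : ∀ {z} Z → (∀ p → W (μ p (z ∷ Z))) → ∀ p → W (μ p Z)
    W-tail Z w p = subst W (identityˡ _) (w λ { zero → false ; (suc n) → p n })

    -- `h` is interpolated along the entries of `Z`: an entry in `q` gives up its share, one outside
    -- `q` gives up `ε`.
    spread : ∀ {h} q Z → (∀ p → W (μ p Z)) → h ≼ μ q Z → G h (μ q Z) →
      ∃[ HR ] merge HR ≡ Z × All-split HR × Carries q h (map proj₁ HR)
    spread q [] w h≼ g with refl ← ≼ε h≼ =
      [] , refl , [] , λ p c _ → sym (⊙-ε c)
    spread {h} q (z ∷ Z) w h≼ g with q 0 in q0
    ... | true =
      let h₁ , h₂ , (r , h₁r) , h₂≼ , h₁h₂ , g₁ , g₂ =
            interpolate (W-head Z w) (W-tail Z w (q ∘ suc)) (subst W (cong (λ b → b ⊙ z ∙ μ (q ∘ suc) Z) q0) (w q)) g h≼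
          HR , m , gs , carries = spread (q ∘ suc) Z (W-tail Z w) h₂≼ g₂
      in (h₁ , r) ∷ HR , cong₂ _∷_ h₁r m , subst (G h₁) (sym h₁r) g₁ ∷ gs , λ p c p≡c → begin
        p 0 ⊙ h₁ ∙ μ (p ∘ suc) (map proj₁ HR)
          ≡⟨ cong₂ (λ b t → b ⊙ h₁ ∙ t) (p≡c 0 (subst T (sym q0) _))
                                       (carries (p ∘ suc) c (p≡c ∘ suc)) ⟩
        c ⊙ h₁ ∙ c ⊙ h₂                         ≡⟨ ⊙-distrib c h₁ h₂ ⟨
        c ⊙ (h₁ ∙ h₂)                           ≡⟨ cong (c ⊙_) h₁h₂ ⟩
        c ⊙ h                                   ∎
      where open ≡-Reasoning
    ... | false =
      let HR , m , gs , carries = spread (q ∘ suc) Z (W-tail Z w)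
            (subst (h ≼_) (identityˡ _) h≼) (subst (G h) (identityˡ _) g)
      in (ε , z) ∷ HR , cong₂ _∷_ (identityˡ z) m
       , subst (G ε) (sym (identityˡ z)) (G-ε (W-head Z w)) ∷ gs
       , λ p c p≡c → trans (cong₂ _∙_ (⊙-ε (p 0)) (carries (p ∘ suc) c (p≡c ∘ suc))) (identityˡ _)

    splitting : ∀ {h} q {Z} → K Z → h ≼ μ q Z → G h (μ q Z) →
      ∃[ HR ] merge HR ≡ Z × K (flatten HR) × Carries q h (map proj₁ HR)
    splitting q {Z} k h≼ g =
      let HR , m , gs , carries = spread q Z (K-W k) h≼ g
      in HR , m , subst K (++-identityʳ _)
           (flatten-K [] gs (subst K (sym (trans (++-identityʳ _) m)) k)) , carries

    -- The entries of `Z` placed in the head add up to `h ∙ r`; spreading `h` over them splits `Z`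
    -- compatibly.
    refine-split : ∀ {h r Y Z} → K Z → Z ≽ h ∙ r ∷ Y → G h (h ∙ r) →
           ∃[ Z′ ] K Z′ × Z′ ≽ Z × Z′ ≽ h ∷ r ∷ Y
    refine-split {h} {r} {Y} k (f , im) g
      with splitting {h} (atZero ∘ f) k (r , eq) (subst (G h) eq g)
      where eq = trans (sym (μ-atZero (h ∙ r) Y)) (im atZero)
    ... | HR , refl , kF , carries = flatten HR , kF , flatten-≽ HR , (place , image)
      where
      open ≡-Reasoning
      H = map proj₁ HR
      R = map proj₂ HR
      place : ℕ → ℕ
      -- Shares of `h` go to entry 0. A remainder moves one place on, so that what is left of the
      -- old head goes to `r`.
      place = interleave (const 0) (suc ∘ f)

      all-H : ∀ c → μ (const c) H ≡ c ⊙ h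
      all-H c = carries (const c) c (λ _ _ → refl)

      some-H : ∀ p → μ (p ∘ f) H ≡ p 0 ⊙ h
      some-H p = carries (p ∘ f) (p 0) λ j → lemma (f j)
        where
        lemma : ∀ n → T (atZero n) → p n ≡ p 0
        lemma zero _ = refl

      -- Adding `p 0 ⊙ h` turns both sides into the same measure of `merge HR`; that summand then
      -- cancels.
      some-R : ∀ p → μ p (r ∷ Y) ≡ μ (p ∘ f) R
      some-R p = cancel (p 0 ⊙ h) (subst ↓_ (sym before) (W⇒↓ (K-W k (p ∘ f)))) (trans before after)
        where
        before : p 0 ⊙ h ∙ μ p (r ∷ Y) ≡ μ (p ∘ f) (merge HR)
        before = begin
          p 0 ⊙ h ∙ (p 0 ⊙ r ∙ μ (p ∘ suc) Y)    ≡⟨ assoc _ _ _ ⟨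
          (p 0 ⊙ h ∙ p 0 ⊙ r) ∙ μ (p ∘ suc) Y    ≡⟨ cong (_∙ _) (⊙-distrib (p 0) h r) ⟨
          μ p (h ∙ r ∷ Y)                        ≡⟨ im p ⟩
          μ (p ∘ f) (merge HR)                   ∎
        after : μ (p ∘ f) (merge HR) ≡ p 0 ⊙ h ∙ μ (p ∘ f) R
        after = trans (μ-merge (p ∘ f) HR) (cong (_∙ _) (some-H p))

      image : ∀ p → μ p (h ∷ r ∷ Y) ≡ μ (p ∘ place) (flatten HR)
      image p = begin
        p 0 ⊙ h ∙ μ (p ∘ suc) (r ∷ Y)              ≡⟨ cong₂ _∙_ (sym (all-H (p 0))) (some-R (p ∘ suc)) ⟩
        μ (const (p 0)) H ∙ μ (p ∘ suc ∘ f) R      ≡⟨ μ-flatten _ _ HR ⟨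
        μ (interleave (const (p 0)) (p ∘ suc ∘ f)) (flatten HR)
          ≡⟨ μ-cong (flatten HR) (∘-interleave p (const 0) (suc ∘ f)) ⟩
        μ (p ∘ place) (flatten HR)                 ∎

    -- Induction on how `X` was obtained; `refine-split` lifts a split of `X` to the common
    -- refinement.
    Common-along : ∀ {X Y} → (∀ {Z} → C Z → Common Z Y) → K X → Common X Y
    Common-along c₀ (base c) = c₀ c
    Common-along c₀ (coarsen k ≽X) = let Z , kZ , ZX , ZY = Common-along c₀ k
                                     in Z , kZ , ≽-trans ZX ≽X , ZY
    Common-along c₀ (split g k) =
      let Z , kZ , ZX , ZY = Common-along c₀ k
          Z′ , kZ′ , Z′Z , Z′X = refine-split kZ ZX g
      in Z′ , kZ′ , Z′X , ≽-trans Z′Z ZY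

    -- Applied along `X` and, within its base case, along `Y`, `Common-along` reduces the claim to
    -- starting partitions.
    directed : ∀ {X Y} → K X → K Y → Common X Y
    directed kX kY = Common-along
      (λ c → Common-sym (Common-along
        (λ c′ → let Z , cZ , ZX , ZY = directed₀ c′ c in Z , base cZ , ZX , ZY) kY)) kX

-- Homogeneity and sub-effect algebras with Riesz decomposition.

module RieszSubs (S : EffectMonoid ℓ) where

  open EffectMonoid S
  open EffectMonoidProperties S

  Homogeneity : Set ℓ
  Homogeneity = ∀ {h x y} → ↓ h ∙ (x ∙ y) → h ≼ x ∙ y →
                ∃[ h₁ ] ∃[ h₂ ] h₁ ≼ x × h₂ ≼ y × h₁ ∙ h₂ ≡ h

  record IsRieszSub (Q : Pred M q) : Set (ℓ ⊔ q) where
    field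
      defined : ∀ {x} → Q x → ↓ x
      ⊤∈      : Q ⊤
      compl   : ∀ {x y} → Q x → x ∙ y ≡ ⊤ → Q y
      sum     : ∀ {x y} → Q x → Q y → ↓ x ∙ y → Q (x ∙ y)
      riesz   : ∀ {u x y} → Q u → Q x → Q y → ↓ x ∙ y → u ≼ x ∙ y →
                ∃[ u₁ ] ∃[ u₂ ] Q u₁ × Q u₂ × u₁ ≼ x × u₂ ≼ y × u₁ ∙ u₂ ≡ u

    ε∈ : Q ε
    ε∈ = compl ⊤∈ (identityʳ ⊤)

    -- `y` is the complement of the sum of `x` and the complement of `x ∙ y`.
    diff : ∀ {x y} → Q x → Q (x ∙ y) → Q y
    diff {x} {y} Qx Qxy =
      let s , e = defined Qxy
          eq = trans (solve 3 (λ x y s → (x ⊕ s) ⊕ y ⊜ (x ⊕ y) ⊕ s) refl x y s) e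
      in compl (sum Qx (compl Qxy e) (y , eq)) eq

-- The sub-effect algebra spanned by directed partitions.

module Span (ext : ∀ {a b} → Extensionality a b) (S : EffectMonoid ℓ)
  (homogeneous : RieszSubs.Homogeneity S)
  (C : Pred (List (EffectMonoid.M S)) ℓ)
  (C-total : ∀ {Z} → C Z → Measures.μ ext S (const true) Z ≡ EffectMonoid.⊤ S)
  (directed₀ : ∀ {X Y} → C X → C Y →
    ∃[ Z ] C Z × Measures._≽_ ext S Z X × Measures._≽_ ext S Z Y)
  (Z₀ : List (EffectMonoid.M S)) (CZ₀ : C Z₀)
  where

  open EffectMonoid S
  open EffectMonoidProperties S
  open Measures ext S
  open RieszSubs S
  open Partitions ext S C C-total (λ h b → ↓ h ∙ b)

  interpolate : ∀ {h x y} → ↓ x → ↓ y → ↓ x ∙ y → ↓ h ∙ (x ∙ y) → h ≼ x ∙ y →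
    ∃[ h₁ ] ∃[ h₂ ] h₁ ≼ x × h₂ ≼ y × h₁ ∙ h₂ ≡ h × ↓ h₁ ∙ x × ↓ h₂ ∙ y
  interpolate _ _ _ d h≼ =
    let h₁ , h₂ , h₁≼ , h₂≼ , e = homogeneous d h≼
    in h₁ , h₂ , h₁≼ , h₂≼ , e ,
       ↓-≼ (∙-mono (subst (h₁ ≼_) e x≼x∙y) x≼x∙y) d ,
       ↓-≼ (∙-mono (subst (h₂ ≼_) e y≼x∙y) y≼x∙y) d

  open Refinable ↓_ K-defined id (subst ↓_ (sym (identityˡ _))) interpolate directed₀

  Mem : Pred M ℓ
  Mem x = ∃[ Z ] Σ[ p ∈ (ℕ → Bool) ] K Z × μ p Z ≡ x

  mem-⊤ : Mem ⊤
  mem-⊤ = Z₀ , const true , base CZ₀ , C-total CZ₀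

  mem-defined : ∀ {x} → Mem x → ↓ x
  mem-defined (Z , p , k , refl) = K-defined k p

  complement-sum : ∀ {Z} p → K Z → μ p Z ∙ μ (not ∘ p) Z ≡ ⊤
  complement-sum {Z} p k = trans (sym (μ-split (const true) p Z)) (K-total k)

  mem-compl : ∀ {x y} → Mem x → x ∙ y ≡ ⊤ → Mem y
  mem-compl {x} {y} (Z , p , k , refl) e =
    Z , not ∘ p , k ,
    cancel x (subst ↓_ (sym eq) ↓⊤) (trans eq (sym e))
    where eq = complement-sum p k

  -- `y` can be split off the entries that make up `x`; the parts split off then measure `y`.
  mem-summand : ∀ {x y} → Mem x → y ≼ x → ↓ y ∙ x → Mem y
  mem-summand {x} {y} (Z , p , k , refl) y≼x d with splitting p k y≼x d
  ... | HR , refl , kF , carries = flatten HR , interleave p (const false) , kF , (begin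
    μ (interleave p (const false)) (flatten HR)               ≡⟨ μ-flatten p (const false) HR ⟩
    μ p (map proj₁ HR) ∙ μ (const false) (map proj₂ HR)
      ≡⟨ cong₂ _∙_ (carries p true λ j → Equivalence.to T-≡) (μ-false (map proj₂ HR)) ⟩
    y ∙ ε                                                     ≡⟨ identityʳ y ⟩
    y                                                         ∎)
    where open ≡-Reasoning

  Disjoint : (p q : ℕ → Bool) → Set
  Disjoint p q = ∀ n → p n ∧ q n ≡ false

  μ-∨ : ∀ {p q} → Disjoint p q → ∀ Z → μ (λ n → p n ∨ q n) Z ≡ μ p Z ∙ μ q Z
  μ-∨ {p} {q} dis Z = trans (μ-split _ p Z)
    (cong₂ _∙_ (μ-cong Z λ n → fst (p n) (q n)) (μ-cong Z λ n → snd (p n) (q n) (dis n)))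
    where
    fst : ∀ b c → (b ∨ c) ∧ b ≡ b
    fst false false = refl
    fst false true  = refl
    fst true  c     = refl
    snd : ∀ b c → b ∧ c ≡ false → (b ∨ c) ∧ not b ≡ c
    snd false false _ = refl
    snd false true  _ = refl
    snd true  c     e = sym e

  interleave-disjoint : ∀ {p p′ q q′} → Disjoint p p′ → Disjoint q q′ →
                        Disjoint (interleave p q) (interleave p′ q′)
  interleave-disjoint d d′ zero          = d 0
  interleave-disjoint d d′ (suc zero)    = d′ 0
  interleave-disjoint d d′ (suc (suc n)) = interleave-disjoint (d ∘ suc) (d′ ∘ suc) n

  -- Two overlapping masks are made disjoint by copying their overlap h: as
  -- the measures add up, h is a summand of the entries lying in neither mask.
  abstract
    disjointify : ∀ {Z} p q → K Z → ↓ μ p Z ∙ μ q Z →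
      ∃[ Z′ ] Σ[ p′ ∈ (ℕ → Bool) ] Σ[ q′ ∈ (ℕ → Bool) ]
        K Z′ × Disjoint p′ q′ × μ p′ Z′ ≡ μ p Z × μ q′ Z′ ≡ μ q Z
    disjointify {Z} p q k (s , total) = copy (splitting n k (s , sym outside) h⊥n)
      where
      open ≡-Reasoning
      n p∖q q∖p : ℕ → Bool
      n   j = not (p j) ∧ not (q j)
      p∖q j = p j ∧ not (q j)
      q∖p j = q j ∧ not (p j)
      h u v : M
      h = μ (λ j → p j ∧ q j) Z
      u = μ p∖q Z
      v = μ q∖p Z

      p-split : μ p Z ≡ h ∙ u
      p-split = μ-split p q Z

      q-split : μ q Z ≡ h ∙ v
      q-split = trans (μ-split q p Z)
        (cong (_∙ v) (μ-cong Z λ j → ∧-comm (q j) (p j)))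

      not-p-split : μ (not ∘ p) Z ≡ v ∙ μ n Z
      not-p-split = trans (μ-split (not ∘ p) q Z)
        (cong (_∙ μ n Z) (μ-cong Z λ j → ∧-comm (not (p j)) (q j)))

      cells : (h ∙ u ∙ v) ∙ μ n Z ≡ ⊤
      cells = begin
        (h ∙ u ∙ v) ∙ μ n Z      ≡⟨ solve 4 (λ h u v n → (h ⊕ (u ⊕ v)) ⊕ n ⊜ (h ⊕ u) ⊕ (v ⊕ n)) refl h u v _ ⟩
        (h ∙ u) ∙ (v ∙ μ n Z)    ≡⟨ cong₂ _∙_ p-split not-p-split ⟨
        μ p Z ∙ μ (not ∘ p) Z    ≡⟨ complement-sum p k ⟩
        ⊤                        ∎

      outside : μ n Z ≡ h ∙ s
      outside = cancel (h ∙ u ∙ v) (subst ↓_ (sym cells) ↓⊤) (begin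
        (h ∙ u ∙ v) ∙ μ n Z      ≡⟨ cells ⟩
        ⊤                        ≡⟨ total ⟨
        (μ p Z ∙ μ q Z) ∙ s      ≡⟨ cong (_∙ s) (cong₂ _∙_ p-split q-split) ⟩
        ((h ∙ u) ∙ (h ∙ v)) ∙ s
          ≡⟨ solve 4 (λ h u v s → ((h ⊕ u) ⊕ (h ⊕ v)) ⊕ s ⊜ (h ⊕ (u ⊕ v)) ⊕ (h ⊕ s)) refl h u v s ⟩
        (h ∙ u ∙ v) ∙ (h ∙ s)    ∎)

      h⊥n : ↓ h ∙ μ n Z
      h⊥n = ↓-≼ (∙-mono x≼x∙y ≼-refl) (subst ↓_ (sym cells) ↓⊤)

      off-n : ∀ b c → T (not b ∧ not c) → b ≡ false × c ≡ false
      off-n false false _ = refl , refl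

      disjoint-R : ∀ b c → b ∧ (c ∧ not b) ≡ false
      disjoint-R false c     = refl
      disjoint-R true  false = refl
      disjoint-R true  true  = refl

      copy : ∃[ HR ] merge HR ≡ Z × K (flatten HR) × Carries n h (map proj₁ HR) →
             ∃[ Z′ ] Σ[ p′ ∈ (ℕ → Bool) ] Σ[ q′ ∈ (ℕ → Bool) ]
               K Z′ × Disjoint p′ q′ × μ p′ Z′ ≡ μ p Z × μ q′ Z′ ≡ μ q Z
      copy (HR , m , kF , carries) =
        -- The copies of `h` come from entries outside both masks. `p` keeps the overlap, while `q`
        -- trades it for the copies.
        flatten HR , interleave (const false) p , interleave n q∖p , kF ,
        interleave-disjoint (λ _ → refl) (λ j → disjoint-R (p j) (q j)) ,
        trans (μ-flatten (const false) p HR) (trans (cong₂ _∙_ (μ-false H) refl) (trans (identityˡ _)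
          (sym (unaffected p λ j nj → proj₁ (off-n (p j) (q j) nj))))) ,
        (begin
          μ (interleave n q∖p) (flatten HR)   ≡⟨ μ-flatten n q∖p HR ⟩
          μ n H ∙ μ q∖p R
            ≡⟨ cong₂ _∙_ (carries n true λ j → Equivalence.to T-≡)
                         (sym (unaffected q∖p λ j nj →
                           cong (_∧ not (p j)) (proj₂ (off-n (p j) (q j) nj)))) ⟩
          h ∙ v                               ≡⟨ q-split ⟨
          μ q Z                               ∎)
        where
        H R : List M
        H = map proj₁ HR
        R = map proj₂ HR
        unaffected : ∀ r → (∀ j → T (n j) → r j ≡ false) → μ r Z ≡ μ r R
        unaffected r off = begin
          μ r Z              ≡⟨ cong (μ r) m ⟨
          μ r (merge HR)     ≡⟨ μ-merge r HR ⟩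
          μ r H ∙ μ r R      ≡⟨ cong (_∙ μ r R) (carries r false off) ⟩
          ε ∙ μ r R          ≡⟨ identityˡ _ ⟩
          μ r R              ∎

  -- A common refinement carries both elements as masks, which `disjointify` then separates.
  mem-disjoint : ∀ {x y} → Mem x → Mem y → ↓ x ∙ y →
    ∃[ Z ] Σ[ p ∈ (ℕ → Bool) ] Σ[ q ∈ (ℕ → Bool) ]
      K Z × Disjoint p q × μ p Z ≡ x × μ q Z ≡ y
  mem-disjoint (X , p , kX , refl) (Y , q , kY , refl) d with directed kX kY
  ... | Z , kZ , (f , imX) , (g , imY)
    with disjointify (p ∘ f) (q ∘ g) kZ (subst ↓_ (cong₂ _∙_ (imX p) (imY q)) d)
  ... | Z′ , p′ , q′ , kZ′ , dis , ep , eq =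
    Z′ , p′ , q′ , kZ′ , dis , trans ep (sym (imX p)) , trans eq (sym (imY q))

  mem-sum : ∀ {x y} → Mem x → Mem y → ↓ x ∙ y → Mem (x ∙ y)
  mem-sum mx my d with mem-disjoint mx my d
  ... | Z , p , q , k , dis , refl , refl = Z , _ , k , μ-∨ dis Z

  -- The parts of `r` inside `p` and `q` are already on the right sides. The rest `c₃` lies below
  -- `w₁ ∙ w₂`, the parts of `p` and `q` outside `r`, and is orthogonal to it, so homogeneity
  -- divides it.
  riesz-cells : ∀ {Z} p q r → K Z → Disjoint p q → μ r Z ≼ μ p Z ∙ μ q Z →
    ∃[ u₁ ] ∃[ u₂ ] Mem u₁ × Mem u₂ × u₁ ≼ μ p Z × u₂ ≼ μ q Z × u₁ ∙ u₂ ≡ μ r Z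
  riesz-cells {Z} p q r k dis u≼ =
    let s₁ , s₂ , s₁≼w₁ , s₂≼w₂ , s₁s₂ = homogeneous c₃⊥w c₃≼w
        u₁≼ = subst (c₁ ∙ s₁ ≼_) (sym p-split) (∙-monoʳ c₁ s₁≼w₁)
        u₂≼ = subst (c₂ ∙ s₂ ≼_) (sym q-split) (∙-monoʳ c₂ s₂≼w₂)
        -- A summand of `c₃` is orthogonal to every `w` below `w₁ ∙ w₂`, as `mem-summand` demands.
        part : ∀ {s w} → s ≼ c₃ → Mem w → s ≼ w → w ≼ w₁ ∙ w₂ → Mem s
        part s≼c₃ mw s≼w w≼ = mem-summand mw s≼w (↓-≼ (∙-mono s≼c₃ w≼) c₃⊥w)
        ms₁ = part (subst (s₁ ≼_) s₁s₂ x≼x∙y) (cell _) s₁≼w₁ x≼x∙y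
        ms₂ = part (subst (s₂ ≼_) s₁s₂ y≼x∙y) (cell _) s₂≼w₂ y≼x∙y
    in c₁ ∙ s₁ , c₂ ∙ s₂
     , mem-sum (cell _) ms₁ (↓-≼ u₁≼ (K-defined k p))
     , mem-sum (cell _) ms₂ (↓-≼ u₂≼ (K-defined k q))
     , u₁≼ , u₂≼ , (begin
       (c₁ ∙ s₁) ∙ (c₂ ∙ s₂)
         ≡⟨ solve 4 (λ c s d t → (c ⊕ s) ⊕ (d ⊕ t) ⊜ (c ⊕ d) ⊕ (s ⊕ t)) refl c₁ s₁ c₂ s₂ ⟩
       (c₁ ∙ c₂) ∙ (s₁ ∙ s₂)    ≡⟨ cong ((c₁ ∙ c₂) ∙_) s₁s₂ ⟩
       (c₁ ∙ c₂) ∙ c₃           ≡⟨ cells r ⟨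
       μ r Z                    ∎)
    where
    open ≡-Reasoning
    in-p in-q in-rest : (ℕ → Bool) → M
    in-p    t = μ (λ j → t j ∧ p j) Z
    in-q    t = μ (λ j → (t j ∧ not (p j)) ∧ q j) Z
    in-rest t = μ (λ j → (t j ∧ not (p j)) ∧ not (q j)) Z
    c₁ c₂ c₃ w₁ w₂ : M
    c₁ = in-p r
    c₂ = in-q r
    c₃ = in-rest r
    w₁ = in-p (not ∘ r)
    w₂ = in-q (not ∘ r)

    cell : ∀ t → Mem (μ t Z)
    cell t = Z , t , k , refl

    cells : ∀ t → μ t Z ≡ (in-p t ∙ in-q t) ∙ in-rest t
    cells t = trans (μ-split t p Z)
      (trans (cong (in-p t ∙_) (μ-split _ q Z)) (sym (assoc _ _ _)))

    p-split : μ p Z ≡ c₁ ∙ w₁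
    p-split = trans (μ-split p r Z)
      (cong₂ _∙_ (μ-cong Z λ j → ∧-comm (p j) (r j)) (μ-cong Z λ j → ∧-comm (p j) (not (r j))))

    q-split : μ q Z ≡ c₂ ∙ w₂
    q-split = trans (μ-split q r Z)
      (cong₂ _∙_ (μ-cong Z λ j → lemma (p j) (q j) (r j) (dis j))
                 (μ-cong Z λ j → lemma (p j) (q j) (not (r j)) (dis j)))
      where
      lemma : ∀ b c d → b ∧ c ≡ false → c ∧ d ≡ (d ∧ not b) ∧ c
      lemma false false d _ = sym (∧-zeroʳ _)
      lemma false true  d _ = sym (trans (∧-identityʳ _) (∧-identityʳ d))
      lemma true  false d _ = sym (∧-zeroʳ _)

    c₃⊥w : ↓ c₃ ∙ (w₁ ∙ w₂)
    c₃⊥w = ↓-≼ (∙-mono (subst (c₃ ≼_) (sym (cells r)) y≼x∙y)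
                       (subst (w₁ ∙ w₂ ≼_) (sym (cells (not ∘ r))) x≼x∙y))
               (subst ↓_ (sym (complement-sum r k)) ↓⊤)

    c₃≼w : c₃ ≼ w₁ ∙ w₂
    c₃≼w = ∙-cancel-≼ (c₁ ∙ c₂)
      (subst ↓_ regroup (subst ↓_ (μ-∨ dis Z) (K-defined k _)))
      (subst (_≼ (c₁ ∙ c₂) ∙ (w₁ ∙ w₂)) (cells r) (subst (μ r Z ≼_) regroup u≼))
      where
      regroup : μ p Z ∙ μ q Z ≡ (c₁ ∙ c₂) ∙ (w₁ ∙ w₂)
      regroup = trans (cong₂ _∙_ p-split q-split) (interchange c₁ w₁ c₂ w₂)

  mem-riesz : ∀ {u x y} → Mem u → Mem x → Mem y → ↓ x ∙ y → u ≼ x ∙ y →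
    ∃[ u₁ ] ∃[ u₂ ] Mem u₁ × Mem u₂ × u₁ ≼ x × u₂ ≼ y × u₁ ∙ u₂ ≡ u
  mem-riesz (U , r , kU , refl) mx my d u≼ with mem-disjoint mx my d
  ... | X , p , q , kX , dis , refl , refl with directed kU kX
  ...   | Z , kZ , (g , imU) , (f , imX) rewrite imU r | imX p | imX q =
    riesz-cells (p ∘ f) (q ∘ f) (r ∘ g) kZ (dis ∘ f) u≼

  isRieszSub : IsRieszSub Mem
  isRieszSub = record
    { defined = mem-defined
    ; ⊤∈      = mem-⊤
    ; compl   = mem-compl
    ; sum     = mem-sum
    ; riesz   = mem-riesz
    }

-- Existence of blocks and their closure under orthogonal summands.

module Blocks (em : ∀ {a} → ExcludedMiddle a) (ext : ∀ {a b} → Extensionality a b)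
  (S : EffectMonoid ℓ) (homogeneous : RieszSubs.Homogeneity S) where

  open EffectMonoid S
  open EffectMonoidProperties S
  open Measures ext S
  open RieszSubs S
  open Subsets em {A = M}

  record IsMaximalRieszSub (Q : Pred M ℓ) : Set (lsuc ℓ) where
    field
      isRieszSub : IsRieszSub Q
      maximal    : ∀ (R : Pred M ℓ) → IsRieszSub R → (∀ {x} → Q x → R x) → ∀ {x} → R x → Q x
    open IsRieszSub isRieszSub public

  element-in-sub : ∀ {x} → ↓ x → Σ[ Q ∈ Pred M ℓ ] IsRieszSub Q × Q x
  element-in-sub {x} (x′ , xx′) = Mem , isRieszSub , (_ , atZero , base refl , μ-atZero x (x′ ∷ []))
    where
    C : Pred (List M) ℓ
    C Z = Z ≡ x ∷ x′ ∷ []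
    total : ∀ {Z} → C Z → μ (const true) Z ≡ ⊤
    total refl = trans (cong (x ∙_) (identityʳ x′)) xx′
    directed : ∀ {X Y} → C X → C Y → ∃[ Z ] C Z × Z ≽ X × Z ≽ Y
    directed refl refl = _ , refl , ≽-refl , ≽-refl
    open Partitions ext S C total (λ h b → ↓ h ∙ b) using (base)
    open Span ext S homogeneous C total directed _ refl

  module _ {Q : Pred M ℓ} (sub : IsRieszSub Q) where
    open IsRieszSub sub

    private
      C : Pred (List M) ℓ
      C Z = Z ≡ ⊤ ∷ []

      total : ∀ {Z} → C Z → μ (const true) Z ≡ ⊤
      total refl = identityʳ ⊤

      -- Starting from `⊤` alone and splitting by members of `Q` yields partitions inside `Q`.
      module P = Partitions ext S C total (λ h _ → Q h)
      open P using (base; coarsen; split)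

      Q-⊙ : ∀ b {x} → Q x → Q (b ⊙ x)
      Q-⊙ false Qx = ε∈
      Q-⊙ true  Qx = Qx

      K-Q : ∀ {Z} → P.K Z → ∀ p → Q (μ p Z)
      K-Q (base refl) p = subst Q (sym (identityʳ _)) (Q-⊙ (p 0) ⊤∈)
      K-Q (coarsen k (f , im)) p = subst Q (sym (im p)) (K-Q k (p ∘ f))
      K-Q k@(split {h} {r} {Y} Qh k₀) p =
        sum (Q-⊙ (p 0) Qh) (sum (Q-⊙ (p 1) Qr) (QY (p ∘ suc ∘ suc)) (↓-≼ y≼x∙y d)) d
        where
        d : ↓ μ p (h ∷ r ∷ Y)
        d = P.K-defined k p
        Qr : Q r
        Qr = diff Qh (subst Q (μ-atZero (h ∙ r) Y) (K-Q k₀ atZero))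
        QY : ∀ p → Q (μ p Y)
        QY p = subst Q (identityˡ _) (K-Q k₀ λ { zero → false ; (suc n) → p n })

      interpolate : ∀ {h x y} → Q x → Q y → Q (x ∙ y) → Q h → h ≼ x ∙ y →
        ∃[ h₁ ] ∃[ h₂ ] h₁ ≼ x × h₂ ≼ y × h₁ ∙ h₂ ≡ h × Q h₁ × Q h₂
      interpolate Qx Qy Qxy Qh h≼ =
        let h₁ , h₂ , Q₁ , Q₂ , h₁≼ , h₂≼ , e = riesz Qh Qx Qy (defined Qxy) h≼
        in h₁ , h₂ , h₁≼ , h₂≼ , e , Q₁ , Q₂

      directed₀ : ∀ {X Y} → C X → C Y → ∃[ Z ] C Z × Z ≽ X × Z ≽ Y
      directed₀ refl refl = _ , refl , ≽-refl , ≽-refl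

      open P.Refinable Q K-Q defined (λ _ → ε∈) interpolate directed₀ using (directed)

      -- The partitions inside `Q` now serve as starting partitions, and further splits ask only for
      -- orthogonality.
      open Span ext S homogeneous P.K P.K-total directed _ (base refl)
      module P′ = Partitions ext S P.K P.K-total (λ h b → ↓ h ∙ b)

      Q⊆Mem : ∀ {x} → Q x → Mem x
      Q⊆Mem {x} Qx = let x′ , e = defined Qx in
        x ∷ x′ ∷ [] , atZero ,
        P′.base (split Qx (base (cong (_∷ []) e))) , μ-atZero x (x′ ∷ [])

    enlarge : Σ[ R ∈ Pred M ℓ ] IsRieszSub R × (∀ {x} → Q x → R x) ×
              (∀ {x y} → Q x → y ≼ x → ↓ y ∙ x → R y)
    enlarge = Mem , isRieszSub , Q⊆Mem , λ Qx → mem-summand (Q⊆Mem Qx)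

  summand-closed : ∀ {Q} → IsMaximalRieszSub Q → ∀ {x y} → Q x → y ≼ x → ↓ y ∙ x → Q y
  summand-closed block Qx y≼x d =
    let R , subR , Q⊆R , closed = enlarge isRieszSub in maximal R subR Q⊆R (closed Qx y≼x d)
    where open IsMaximalRieszSub block

  IsRieszSub-resp : {Q : Pred M p} {R : Pred M q} → (∀ {x} → Q x → R x) → (∀ {x} → R x → Q x) →
                    IsRieszSub Q → IsRieszSub R
  IsRieszSub-resp to from sub = record
    { defined = λ Rx → defined (from Rx)
    ; ⊤∈      = to ⊤∈
    ; compl   = λ Rx e → to (compl (from Rx) e)
    ; sum     = λ Rx Ry d → to (sum (from Rx) (from Ry) d)
    ; riesz   = λ Ru Rx Ry d u≼ →
        let u₁ , u₂ , Q₁ , Q₂ , rest = riesz (from Ru) (from Rx) (from Ry) d u≼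
        in u₁ , u₂ , to Q₁ , to Q₂ , rest
    }
    where open IsRieszSub sub

  -- Each condition starts from at most three members, so a subset containing these suffices.
  subs-local : Local (λ U → IsRieszSub (_∈ U))
  subs-local U h = record
    { defined = λ {x} x∈ → case h (x ∷ []) (x∈ ∷ []) of λ where
        (V , sub , V⊆U , x∈V ∷ []) → defined sub x∈V
    ; ⊤∈      = case h [] [] of λ where
        (V , sub , V⊆U , []) → V⊆U (⊤∈ sub)
    ; compl   = λ {x} x∈ e → case h (x ∷ []) (x∈ ∷ []) of λ where
        (V , sub , V⊆U , x∈V ∷ []) → V⊆U (compl sub x∈V e)
    ; sum     = λ {x} {y} x∈ y∈ d → case h (x ∷ y ∷ []) (x∈ ∷ y∈ ∷ []) of λ where
        (V , sub , V⊆U , x∈V ∷ y∈V ∷ []) → V⊆U (sum sub x∈V y∈V d)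
    ; riesz   = λ {u} {x} {y} u∈ x∈ y∈ d u≼ →
        case h (u ∷ x ∷ y ∷ []) (u∈ ∷ x∈ ∷ y∈ ∷ []) of λ where
          (V , sub , V⊆U , u∈V ∷ x∈V ∷ y∈V ∷ []) →
            let u₁ , u₂ , u₁∈ , u₂∈ , rest = riesz sub u∈V x∈V y∈V d u≼
            in u₁ , u₂ , V⊆U u₁∈ , V⊆U u₂∈ , rest
    }
    where open IsRieszSub

  abstract
    element-in-block : ∀ {x} → ↓ x → Σ[ Q ∈ Pred M ℓ ] IsMaximalRieszSub Q × Q x
    element-in-block {x} d with element-in-sub d
    ... | Q₀ , sub₀ , x∈Q₀
      with Zorn.maximal em ext (λ U → IsRieszSub (_∈ U)) subs-local ⟪ Q₀ ⟫
             (IsRieszSub-resp (∈⁺ Q₀) (∈⁻ Q₀) sub₀)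
    ... | U , (subU , maxU) , Q₀⊆U =
      (λ x → Lift ℓ (x ∈ U)) ,
      record
        { isRieszSub = IsRieszSub-resp lift lower subU
        ; maximal    = λ R subR U⊆R Rx →
            lift (maxU ⟪ R ⟫ (IsRieszSub-resp (∈⁺ R) (∈⁻ R) subR) (λ x∈U → ∈⁺ R (U⊆R (lift x∈U))) (∈⁺ R Rx))
        } ,
      lift (Q₀⊆U (∈⁺ Q₀ x∈Q₀))

-- Maximal common lower bounds of an orthogonal pair.

module Bounds (em : ∀ {a} → ExcludedMiddle a) (ext : ∀ {a b} → Extensionality a b)
  (S : EffectMonoid ℓ) (homogeneous : RieszSubs.Homogeneity S) where

  open EffectMonoid S
  open EffectMonoidProperties S
  open RieszSubs S
  open Subsets em {A = M}
  open import Algebra.Definitions.RawMonoid rawMonoid using () renaming (_×_ to _·_)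

  ∑ : List M → M
  ∑ = foldr _∙_ ε

  ArchimedeanMonoid : Set ℓ
  ArchimedeanMonoid = ∀ x → x ≢ ε → ∃[ n ] ∀ m → ↓ m · x → m ℕ.≤ n

  SumsBelow : Pred M ℓ → M → Set ℓ
  SumsBelow A u = ∀ K → Unique K → All A K → ∑ K ≼ u

  InterpolatingBounds : Set (lsuc ℓ)
  InterpolatingBounds = ∀ A {u v} → ↓ u → ↓ v → SumsBelow A u → SumsBelow A v →
                        ∃[ w ] SumsBelow A w × w ≼ u × w ≼ v

  IsAtom : M → Set ℓ
  IsAtom d = d ≢ ε × (∀ x → x ≼ d → x ≡ ε ⊎ x ≡ d)

  largest : (P : ℕ → Set ℓ) → P 0 → ∀ n → (∀ m → P m → m ℕ.≤ n) →
            ∃[ k ] P k × (∀ m → P m → m ℕ.≤ k)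
  largest P P0 zero bound = 0 , P0 , bound
  largest P P0 (suc n) bound with em {P = P (suc n)}
  ... | yes Pn = suc n , Pn , bound
  ... | no ¬Pn = largest P P0 n λ m Pm → ≤∧≢⇒≤pred (bound m Pm) λ { refl → ¬Pn Pm }
    where
    ≤∧≢⇒≤pred : ∀ {m} → m ℕ.≤ suc n → m ≢ suc n → m ℕ.≤ n
    ≤∧≢⇒≤pred m≤ m≢ = s≤s⁻¹ (≤∧≢⇒< m≤ m≢)

  ·-mono : ∀ x {m n} → m ℕ.≤ n → m · x ≼ n · x
  ·-mono x ℕ.z≤n       = ε≼
  ·-mono x (ℕ.s≤s m≤n) = ∙-monoʳ x (·-mono x m≤n)

  -- Homogeneity decomposes `y` along the copies of `d`, and a nonzero part of an atom is the atom.
  atom-≼-multiple : ∀ {d y} k → IsAtom d → y ≢ ε → y ≼ k · d → ↓ y ∙ (k · d) → d ≼ y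
  atom-≼-multiple zero atom y≢ε y≼ _ = ⊥-elim (y≢ε (≼ε y≼))
  atom-≼-multiple {d} (suc k) atom@(_ , below) y≢ε y≼ dy with homogeneous dy y≼
  ... | y₁ , y₂ , y₁≼ , y₂≼ , refl with below y₁ y₁≼
  ...   | inj₂ refl = x≼x∙y
  ...   | inj₁ refl = ≼-trans
    (atom-≼-multiple k atom (λ e → y≢ε (trans (identityˡ y₂) e)) y₂≼ (↓-≼ (∙-mono y≼x∙y y≼x∙y) dy))
    y≼x∙y

  module _ {U V : M} (U⊥V : ↓ U ∙ V) where

    Lower : Pred M ℓ
    Lower x = x ≼ U × x ≼ V

    Lower-≼ : ∀ {x y} → x ≼ y → Lower y → Lower x
    Lower-≼ x≼y (y≼U , y≼V) = ≼-trans x≼y y≼U , ≼-trans x≼y y≼V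

    ↓U : ↓ U
    ↓U = ↓-≼ x≼x∙y U⊥V

    ↓V : ↓ V
    ↓V = ↓-≼ y≼x∙y U⊥V

    Lower-↓ : ∀ {x} → Lower x → ↓ x
    Lower-↓ (x≼U , _) = ↓-≼ x≼U ↓U

    -- An orthogonal set cannot contain an atom d with multiplicity; instead it
    -- is to contain the largest multiple of d.
    Saturated : Pred M ℓ
    Saturated a = ∀ d → IsAtom d → d ≼ a → ∀ k → Lower (k · d) → k · d ≼ a

    record Admissible (A : M → Bool) : Set ℓ where
      field
        sums      : ∀ K → Unique K → All (_∈ A) K → Lower (∑ K)
        saturated : ∀ a → a ∈ A → Saturated a
    open Admissible

    admissible-local : Local Admissible
    admissible-local A h = record
      { sums      = λ K unique K⊆A → case h K K⊆A of λ where
          (B , adm , _ , K⊆B) → sums adm K unique K⊆B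
      ; saturated = λ a a∈A → case h (a ∷ []) (a∈A ∷ []) of λ where
          (B , adm , _ , a∈B ∷ []) → saturated adm a a∈B
      }

    -- As `K` is duplicate-free, `e` occurs at most once. The freshness clause carries uniqueness
    -- through the induction.
    extract : ∀ {A : M → Bool} e K → Unique K → All (λ x → x ≡ e ⊎ x ∈ A) K →
      All (_∈ A) K ⊎
      (∃[ K′ ] Unique K′ × All (_∈ A) K′ × ∑ K ≡ ∑ K′ ∙ e ×
               (∀ {x} → All (x ≢_) K → All (x ≢_) K′))
    extract e [] [] [] = inj₁ []
    extract {A} e (k ∷ K) (k∉K ∷ unique) (inj₁ refl ∷ K⊆) =
      inj₂ (K , unique , All.zipWith drop (k∉K , K⊆) , comm e (∑ K) , λ { (_ ∷ x∉K) → x∉K })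
      where
      drop : ∀ {x} → e ≢ x × (x ≡ e ⊎ x ∈ A) → x ∈ A
      drop (e≢x , inj₁ x≡e) = ⊥-elim (e≢x (sym x≡e))
      drop (_   , inj₂ x∈A) = x∈A
    extract {A} e (k ∷ K) (k∉K ∷ unique) (inj₂ k∈A ∷ K⊆) with extract {A} e K unique K⊆
    ... | inj₁ K⊆A = inj₁ (k∈A ∷ K⊆A)
    ... | inj₂ (K′ , unique′ , K′⊆A , eq , fresh) =
      inj₂ (k ∷ K′ , fresh k∉K ∷ unique′ , k∈A ∷ K′⊆A ,
            trans (cong (k ∙_) eq) (sym (assoc k _ e)) , λ { (x≢k ∷ x∉K) → x≢k ∷ fresh x∉K })

    -- `A` with `e` inserted is still admissible.
    maximal-absorbs : ∀ {A} → Maximal Admissible A → ∀ {e} → Saturated e →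
      (∀ K → Unique K → All (_∈ A) K → Lower (∑ K ∙ e)) → e ∈ A
    maximal-absorbs {A} (adm , maxA) {e} sat low =
      maxA ⟪ Insert ⟫ admissible (λ x∈A → ∈⁺ Insert (inj₂ x∈A)) (∈⁺ Insert (inj₁ refl))
      where
      Insert : Pred M ℓ
      Insert x = x ≡ e ⊎ x ∈ A

      admissible : Admissible ⟪ Insert ⟫
      admissible = record
        { sums      = λ K unique K⊆ → case extract {A} e K unique (All.map (∈⁻ Insert) K⊆) of λ where
            (inj₁ K⊆A) → sums adm K unique K⊆A
            (inj₂ (K′ , unique′ , K′⊆A , eq , _)) → subst Lower (sym eq) (low K′ unique′ K′⊆A)
        ; saturated = λ a a∈ → case ∈⁻ Insert a∈ of λ where
            (inj₁ refl) → sat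
            (inj₂ a∈A)  → saturated adm a a∈A
        }

    -- A multiple D of an atom not below a passes to the complement of a: its
    -- part below a would be orthogonal to D.
    multiple-avoids : ∀ {d k a r W} → IsAtom d → ¬ d ≼ a → ↓ W ∙ (k · d) → a ∙ r ≼ W →
                      k · d ≼ a ∙ r → k · d ≼ r
    multiple-avoids {d} {k} {a} {r} atom d⋠a W⊥D ar≼W D≼
      with homogeneous (↓-≼ (∙-monoʳ (k · d) ar≼W) (↓-comm W⊥D)) D≼
    ... | y , z , y≼a , z≼r , yz with em {P = y ≡ ε}
    ...   | yes refl = subst (_≼ r) (trans (sym (identityˡ z)) yz) z≼r
    ...   | no y≢ε = ⊥-elim (d⋠a (≼-trans
      (atom-≼-multiple k atom y≢ε (z , yz)
        (↓-≼ (∙-mono (≼-trans y≼a (≼-trans x≼x∙y ar≼W)) ≼-refl) W⊥D)) y≼a))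

    multiple-avoids-sum : ∀ {d k r W} K → IsAtom d → All (λ a → ¬ d ≼ a) K → ↓ W ∙ (k · d) →
                          ∑ K ∙ r ≼ W → k · d ≼ ∑ K ∙ r → k · d ≼ r
    multiple-avoids-sum {r = r} [] atom [] W⊥D _ D≼ = subst (_ ≼_) (identityˡ r) D≼
    multiple-avoids-sum {d} {k} {r} (a ∷ K) atom (d⋠a ∷ d⋠K) W⊥D ≼W D≼ =
      multiple-avoids-sum {k = k} K atom d⋠K W⊥D (≼-trans y≼x∙y ≼W′)
        (multiple-avoids {k = k} atom d⋠a W⊥D ≼W′ (subst (k · d ≼_) (assoc a (∑ K) r) D≼))
      where ≼W′ = subst (_≼ _) (assoc a (∑ K) r) ≼W

    module _ (archimedean : ArchimedeanMonoid) {A : M → Bool} (maxA : Maximal Admissible A)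
      {w : M} (bound : SumsBelow (λ x → Lift ℓ (x ∈ A)) w) {d : M} (wd : Lower (w ∙ d)) (d≢ε : d ≢ ε)
      where

      private
        adm : Admissible A
        adm = proj₁ maxA

        sums≼w : ∀ K → Unique K → All (_∈ A) K → ∑ K ≼ w
        sums≼w K unique K⊆A = bound K unique (All.map lift K⊆A)

        below-d : ∀ {x} → x ≼ d → Lower x
        below-d x≼d = Lower-≼ (≼-trans x≼d y≼x∙y) wd

      -- The largest multiple `D` of `d₀` below `U` and `V` could be added to `A`, so by maximality
      -- it belongs to `A`; yet no member of `A` can lie above `d₀`.
      no-atom-below : ∀ {d₀} → IsAtom d₀ → ¬ d₀ ≼ d
      no-atom-below {d₀} atom@(d₀≢ε , below) d₀≼d
        with archimedean d₀ d₀≢ε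
      ... | n , n-bound
        with largest (λ k → Lower (k · d₀)) (ε≼ , ε≼) n (λ m l → n-bound m (Lower-↓ l))
      ... | k , low-D , k-max = A-avoids D∈A d₀≼D
        where
        D : M
        D = k · d₀

        d₀≼D : d₀ ≼ D
        d₀≼D = subst (_≼ D) (identityʳ d₀) (·-mono d₀ (k-max 1
                 (subst Lower (sym (identityʳ d₀)) (below-d d₀≼d))))

        -- A member above `d₀` contains `D` by saturation, so `w` does too, and adding `d` makes
        -- room for one more copy of `d₀`.
        A-avoids : ∀ {a} → a ∈ A → ¬ d₀ ≼ a
        A-avoids {a} a∈A d₀≼a = 1+n≰n (k-max (suc k) (Lower-≼ d₀D≼wd wd))
          where
          d₀D≼wd : d₀ ∙ D ≼ w ∙ d
          d₀D≼wd = subst (d₀ ∙ D ≼_) (comm d w) (∙-mono d₀≼d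
            (≼-trans (saturated adm a a∈A d₀ atom d₀≼a k low-D)
                     (subst (_≼ w) (identityʳ a) (sums≼w (a ∷ []) ([] ∷ []) (a∈A ∷ [])))))

        -- The only atom below `D` is `d₀`, by `atom-≼-multiple`, and `k` is largest.
        D-saturated : Saturated D
        D-saturated d₁ (d₁≢ε , below₁) d₁≼D m low
          with below₁ d₀ (atom-≼-multiple k atom d₁≢ε d₁≼D
                 (↓-≼ (∙-mono (≼-trans d₁≼D (proj₁ low-D)) (proj₂ low-D)) U⊥V))
        ... | inj₁ refl = ⊥-elim (d₀≢ε refl)
        ... | inj₂ refl = ·-mono d₀ (k-max m low)

        D∈A : D ∈ A
        D∈A = maximal-absorbs maxA D-saturated λ K unique K⊆A →
          let d₀⋠K = All.map A-avoids K⊆A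
              -- `D ≼ W′` makes `D` orthogonal to `W`, so that `D` fits into the remainder `r` of
              -- `∑ K` in `W`.
              add : ∀ {W W′} → ↓ W ∙ W′ → ∑ K ≼ W → D ≼ W → D ≼ W′ → ∑ K ∙ D ≼ W
              add = λ { {W} {W′} d (r , refl) D≼W D≼W′ → ∙-monoʳ (∑ K)
                (multiple-avoids-sum {k = k} K atom d₀⋠K (↓-≼ (∙-monoʳ W D≼W′) d) ≼-refl D≼W) }
              ∑≼U , ∑≼V = sums adm K unique K⊆A
              D≼U , D≼V = low-D
          in add U⊥V ∑≼U D≼U D≼V , add (↓-comm U⊥V) ∑≼V D≼V D≼U

      -- Without atoms below `d` saturation is vacuous, and the new sums stay below `w ∙ d`.
      atomless-∈ : ∀ {e} → e ≼ d → e ∈ A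
      atomless-∈ {e} e≼d = maximal-absorbs maxA
        (λ d₀ atom d₀≼e → ⊥-elim (no-atom-below atom (≼-trans d₀≼e e≼d)))
        (λ K unique K⊆A → Lower-≼ (∙-mono (sums≼w K unique K⊆A) e≼d) wd)

      abstract
        -- Otherwise `f` would be an atom below `d`.
        proper-part : ∀ {f} → f ≢ ε → f ≼ d → ∃[ x ] x ≼ f × x ≢ ε × x ≢ f
        proper-part {f} f≢ε f≼d = decidable-stable em λ none → no-atom-below
          (f≢ε , λ x x≼f → case em {P = x ≡ ε} of λ where
            (yes x≡ε) → inj₁ x≡ε
            (no x≢ε)  → inj₂ (decidable-stable em λ x≢f → none (x , x≼f , x≢ε , x≢f)))
          f≼d

        -- The parts `y` form a strictly descending chain from `f`; by cancellation they stay
        -- distinct when `e` is added.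
        distinct-parts : ∀ e n {f} → f ≢ ε → e ∙ f ≼ d →
          ∃[ K ] length K ≡ n × Unique K × All (λ x → ∃[ y ] x ≡ e ∙ y × y ≼ f) K
        distinct-parts e zero f≢ε ef≼d = [] , refl , [] , []
        distinct-parts e (suc n) {f} f≢ε ef≼d with proper-part f≢ε (≼-trans y≼x∙y ef≼d)
        ... | g , g≼f , g≢ε , g≢f with distinct-parts e n g≢ε (≼-trans (∙-monoʳ e g≼f) ef≼d)
        ... | K , len , unique , parts =
          e ∙ f ∷ K , cong suc len ,
          All.map (λ { (y , refl , y≼g) ef≡ey → g≢f (≼-antisym ↓f g≼f
            (subst (_≼ g) (sym (cancel e ↓ef ef≡ey)) y≼g)) }) parts ∷ unique ,
          (f , refl , ≼-refl) ∷ All.map (λ { (y , eq , y≼g) → y , eq , ≼-trans y≼g g≼f }) parts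
          where
          ↓ef : ↓ e ∙ f
          ↓ef = Lower-↓ (below-d ef≼d)
          ↓f : ↓ f
          ↓f = ↓-≼ y≼x∙y ↓ef

      multiple-≼-∑ : ∀ {e} K → All (e ≼_) K → length K · e ≼ ∑ K
      multiple-≼-∑ []      []          = ≼-refl
      multiple-≼-∑ (x ∷ K) (e≼x ∷ e≼K) = ∙-mono e≼x (multiple-≼-∑ K e≼K)

      -- Without atoms below d = e ∙ f, there are infinitely many y below f. All
      -- the e ∙ y lie in A, so that every multiple of e is defined.
      absurd : ⊥
      absurd with proper-part d≢ε ≼-refl
      ... | e , (f , refl) , e≢ε , e≢d with archimedean e e≢ε
      ... | n , bounded
        with distinct-parts e (suc n) {f} (λ { refl → e≢d (sym (identityʳ e)) }) ≼-refl
      ... | K , len , unique , parts = 1+n≰n (bounded (suc n) (subst (λ m → ↓ m · e) len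
        (↓-≼ (multiple-≼-∑ K (All.map (λ { (y , refl , _) → x≼x∙y }) parts))
             (Lower-↓ (sums adm K unique (All.map
               (λ { (y , refl , y≼f) → atomless-∈ (∙-monoʳ e y≼f) }) parts))))))

    maximal-lower-bound : ArchimedeanMonoid → InterpolatingBounds →
                          ∃[ w ] Lower w × (∀ d → Lower (w ∙ d) → d ≡ ε)
    maximal-lower-bound archimedean bounds
      -- Zorn's lemma starts from the empty set, whose only sum is `ε`.
      with Zorn.maximal em ext Admissible admissible-local (const false) record
        { sums      = λ { [] _ _ → ε≼ , ε≼ ; (_ ∷ _) _ (() ∷ _) }
        ; saturated = λ _ () }
    ... | A , maxA@(adm , _) , _
      with bounds (λ x → Lift ℓ (x ∈ A)) ↓U ↓V
             (λ K unique K⊆A → proj₁ (sums adm K unique (All.map lower K⊆A)))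
             (λ K unique K⊆A → proj₂ (sums adm K unique (All.map lower K⊆A)))
    ... | w , w-bound , low = w , low , λ d wd →
      decidable-stable em λ d≢ε → absurd archimedean maxA w-bound wd d≢ε

-- Riesz interpolation and meets in a block.

module Meets (em : ∀ {a} → ExcludedMiddle a) (ext : ∀ {a b} → Extensionality a b)
  (S : EffectMonoid ℓ) (homogeneous : RieszSubs.Homogeneity S)
  (archimedean : Bounds.ArchimedeanMonoid em ext S homogeneous)
  (bounds : Bounds.InterpolatingBounds em ext S homogeneous)
  {Q : Pred (EffectMonoid.M S) ℓ} (block : Blocks.IsMaximalRieszSub em ext S homogeneous Q)
  where

  open EffectMonoid S
  open EffectMonoidProperties S
  open Blocks em ext S homogeneous
  open Bounds em ext S homogeneous
  open IsMaximalRieszSub block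

  -- Splitting `a₂` along `b₁ = a₁ ∙ x`, and its rest `f` along `g ∙ y`, leaves a part `f₂` below
  -- both `x` and `y`; then `a₁ ∙ f₂` interpolates.
  interpolation : ∀ {a₁ a₂ b₁ b₂} → Q a₁ → Q a₂ → Q b₁ → Q b₂ →
    a₁ ≼ b₁ → a₁ ≼ b₂ → a₂ ≼ b₁ → a₂ ≼ b₂ →
    ∃[ s ] Q s × a₁ ≼ s × a₂ ≼ s × s ≼ b₁ × s ≼ b₂
  interpolation {a₁} Qa₁ Qa₂ Qb₁ Qb₂ (x , refl) (y , refl) a₂≼b₁ a₂≼b₂
    with riesz Qa₂ Qa₁ (diff Qa₁ Qb₁) (defined Qb₁) a₂≼b₁
  ... | e , f , Qe , Qf , (g , refl) , f≼x , refl
    with riesz Qf (diff Qe Qa₁) (diff Qa₁ Qb₂) (↓-≼ y≼x∙y d) f≼gy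
    where
    d : ↓ e ∙ (g ∙ y)
    d = subst ↓_ (assoc e g y) (defined Qb₂)
    f≼gy : f ≼ g ∙ y
    f≼gy = ∙-cancel-≼ e d (subst (e ∙ f ≼_) (assoc e g y) a₂≼b₂)
  ... | f₁ , f₂ , Qf₁ , Qf₂ , f₁≼g , f₂≼y , refl =
    a₁ ∙ f₂ , sum Qa₁ Qf₂ (↓-≼ (∙-monoʳ a₁ f₂≼y) (defined Qb₂)) , x≼x∙y ,
    subst (_≼ a₁ ∙ f₂) (assoc e f₁ f₂) (∙-mono (∙-monoʳ e f₁≼g) ≼-refl) ,
    ∙-monoʳ a₁ (≼-trans y≼x∙y f≼x) , ∙-monoʳ a₁ f₂≼y

  -- With u = p ∙ q, p ≼ v and q orthogonal to v, the elements p ∙ m with m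
  -- below q and below r = v ⊖ p are lower bounds of u and v.
  meet : ∀ {u v} → Q u → Q v →
    ∃[ m ] Q m × m ≼ u × m ≼ v × (∀ {t} → Q t → t ≼ u → t ≼ v → t ≼ m)
  meet {u} {v} Qu Qv with defined Qu | defined Qv
  ... | u′ , uu′ | v′ , vv′
    with riesz Qu Qv (compl Qv vv′) (subst ↓_ (sym vv′) ↓⊤) (u′ , trans uu′ (sym vv′))
  ... | p , q , Qp , Qq , (r , refl) , q≼v′ , refl
    with r⊥q ← ↓-≼ (∙-mono (y≼x∙y {r} {p}) q≼v′) (subst ↓_ (sym vv′) ↓⊤)
    with maximal-lower-bound r⊥q archimedean bounds
  ... | m , (m≼r , m≼q) , m-max =
    p ∙ m , Qpm , pm≼u , pm≼v , greatest
    where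
    pm≼u = ∙-monoʳ p m≼q
    pm≼v = ∙-monoʳ p m≼r

    Qm : Q m
    Qm = summand-closed block (diff Qp Qv) m≼r (↓-≼ (∙-mono m≼q ≼-refl) (↓-comm r⊥q))

    Qpm : Q (p ∙ m)
    Qpm = sum Qp Qm (↓-≼ pm≼v (defined Qv))

    greatest : ∀ {t} → Q t → t ≼ p ∙ q → t ≼ p ∙ r → t ≼ p ∙ m
    greatest Qt t≼u t≼v with interpolation Qpm Qt Qu Qv pm≼u pm≼v t≼u t≼v
    -- The interpolant has the form `(p ∙ m) ∙ d`, and maximality of `m` forces `d` to be `ε`.
    ... | _ , _ , (d , refl) , t≼s , s≼u , s≼v =
      subst (_ ≼_) (trans (cong ((p ∙ m) ∙_) d≡ε) (identityʳ _)) t≼s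
      where
      below : ∀ {z} → ↓ p ∙ z → (p ∙ m) ∙ d ≼ p ∙ z → m ∙ d ≼ z
      below {z} dz s≼ = ∙-cancel-≼ p dz (subst (_≼ p ∙ z) (assoc p m d) s≼)
      d≡ε : d ≡ ε
      d≡ε = m-max d (below (defined Qv) s≼v , below (defined Qu) s≼u)

-- Translation between effect algebras and effect monoids.

module Totalisation (em : ∀ {a} → ExcludedMiddle a) (E : EffectAlgebra ℓ) where

  open EffectAlgebra E

  M : Set ℓ
  M = Maybe Carrier

  infixr 7 _∙_

  sum-if : ∀ {x y} → Dec (∃[ z ] x ⊕ y ≔ z) → M
  sum-if (yes (z , _)) = just z
  sum-if (no _)        = nothing

  _∙_ : M → M → M
  just x  ∙ just y  = sum-if (em {P = ∃[ z ] x ⊕ y ≔ z})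
  just _  ∙ nothing = nothing
  nothing ∙ _       = nothing

  ⊕⇒∙ : ∀ {x y z} → x ⊕ y ≔ z → just x ∙ just y ≡ just z
  ⊕⇒∙ {x} {y} s with em {P = ∃[ z ] x ⊕ y ≔ z}
  ... | yes (_ , s′) = cong just (functional s′ s)
  ... | no none      = contradiction (_ , s) none

  just⇒⊕ : ∀ {x y z} → just x ∙ just y ≡ just z → x ⊕ y ≔ z
  just⇒⊕ {x} {y} e with em {P = ∃[ z ] x ⊕ y ≔ z}
  just⇒⊕ refl | yes (_ , s) = s

  ∙⇒⊕ : ∀ m n {z} → m ∙ n ≡ just z → ∃[ x ] ∃[ y ] m ≡ just x × n ≡ just y × x ⊕ y ≔ z
  ∙⇒⊕ (just x) (just y) e = x , y , refl , refl , just⇒⊕ e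

  -- Reduces the monoid laws to the axioms of the partial operation, which speak of defined values.
  maybe-ext : {m n : M} → (∀ z → m ≡ just z → n ≡ just z) → (∀ z → n ≡ just z → m ≡ just z) → m ≡ n
  maybe-ext {just x}              f g = sym (f x refl)
  maybe-ext {nothing} {nothing} f g = refl
  maybe-ext {nothing} {just y}    f g = g y refl

  ∙-comm : ∀ m n → m ∙ n ≡ n ∙ m
  ∙-comm m n = maybe-ext (half m n) (half n m)
    where
    half : ∀ m n z → m ∙ n ≡ just z → n ∙ m ≡ just z
    half m n z e with ∙⇒⊕ m n e
    ... | x , y , refl , refl , s = ⊕⇒∙ (comm s)

  ∙-assoc : ∀ l m n → (l ∙ m) ∙ n ≡ l ∙ (m ∙ n)
  ∙-assoc l m n = maybe-ext to from
    where
    to : ∀ w → (l ∙ m) ∙ n ≡ just w → l ∙ (m ∙ n) ≡ just w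
    to w e with ∙⇒⊕ (l ∙ m) n e
    ... | u , z , lm , refl , s with ∙⇒⊕ l m lm
    ... | x , y , refl , refl , s′ =
      let v , t , t′ = Equivalence.to assoc (u , s′ , s)
      in trans (cong (just x ∙_) (⊕⇒∙ t)) (⊕⇒∙ t′)
    from : ∀ w → l ∙ (m ∙ n) ≡ just w → (l ∙ m) ∙ n ≡ just w
    from w e with ∙⇒⊕ l (m ∙ n) e
    ... | x , v , refl , mn , s with ∙⇒⊕ m n mn
    ... | y , z , refl , refl , s′ =
      let u , t , t′ = Equivalence.from assoc (v , s′ , s)
      in trans (cong (_∙ just z) (⊕⇒∙ t)) (⊕⇒∙ t′)

  complement-sum : ∀ x → x ⊕ x ′ ≔ 1#
  complement-sum x = proj₁ (proj₂ (complement x))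

  complement-unique : ∀ {x y} → x ⊕ y ≔ 1# → x ′ ≡ y
  complement-unique {x} = proj₂ (proj₂ (complement x))

  ′-involutive : ∀ x → (x ′) ′ ≡ x
  ′-involutive x = complement-unique (comm (complement-sum x))

  -- Every element is a complement. For `y ′`, associativity makes `y ′ ⊕ 0#` another complement of
  -- `y`.
  ⊕-identityʳ : ∀ x → x ⊕ 0# ≔ x
  ⊕-identityʳ x = subst (λ y → y ⊕ 0# ≔ y) (′-involutive x) (complement-identity (x ′))
    where
    complement-identity : ∀ y → y ′ ⊕ 0# ≔ (y ′)
    complement-identity y with Equivalence.to assoc (1# , complement-sum y , 1⊕0≔1)
    ... | v , s , t = subst (y ′ ⊕ 0# ≔_) (sym (complement-unique t)) s

  effectMonoid : EffectMonoid ℓ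
  effectMonoid = record
    { M   = M
    ; _∙_ = _∙_
    ; ε   = just 0#
    ; ⊤   = just 1#
    ; isCommutativeMonoid = isCommutativeMonoidˡ record
      { isSemigroup = record
        { isMagma = record { isEquivalence = isEquivalence ; ∙-cong = cong₂ _∙_ }
        ; assoc   = ∙-assoc
        }
      ; identityˡ = λ { (just x) → ⊕⇒∙ (comm (⊕-identityʳ x)) ; nothing → refl }
      ; comm      = ∙-comm
      }
    ; cancel  = cancel
    ; ⊤-isTop = top
    }
    where
    -- `b` and `b′` are complements of the same element, the sum of `a` and `c ′`.
    ⊕-cancel : ∀ {a b b′ c} → a ⊕ b ≔ c → a ⊕ b′ ≔ c → b ≡ b′
    ⊕-cancel {a} {b} {b′} {c} s s′
      with Equivalence.to assoc (c , comm s , complement-sum c)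
         | Equivalence.to assoc (c , comm s′ , complement-sum c)
    ... | v , t , e | v′ , t′ , e′ with refl ← functional t t′ =
      trans (sym (complement-unique (comm e))) (complement-unique (comm e′))

    cancel : ∀ l {m n} → ∃[ k ] (l ∙ m) ∙ k ≡ just 1# → l ∙ m ≡ l ∙ n → m ≡ n
    cancel l {m} {n} (k , e) eq with ∙⇒⊕ (l ∙ m) k e
    ... | c , _ , lm , _ with ∙⇒⊕ l m lm | ∙⇒⊕ l n (trans (sym eq) lm)
    ... | a , b , refl , refl , s | a , b′ , refl , refl , s′ = cong just (⊕-cancel s s′)

    top : ∀ {m} → ∃[ k ] (just 1# ∙ m) ∙ k ≡ just 1# → m ≡ just 0#
    top {m} (k , e) with ∙⇒⊕ (just 1# ∙ m) k e
    ... | _ , _ , s , _ with ∙⇒⊕ (just 1#) m s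
    ... | _ , _ , refl , refl , t = cong just (zero-one (_ , t))

  open EffectMonoid effectMonoid public using (↓_; _≼_)
  open EffectMonoidProperties effectMonoid
  open RieszSubs effectMonoid using (Homogeneity)

  ↓-just : ∀ x → ↓ just x
  ↓-just x = just (x ′) , ⊕⇒∙ (complement-sum x)

  just-↓ : ∀ {m} → ↓ m → ∃[ x ] m ≡ just x
  just-↓ {m} (k , e) with ∙⇒⊕ m k e
  ... | x , _ , refl , _ = x , refl

  ≤⇒≼ : ∀ {x y} → x ≤ y → just x ≼ just y
  ≤⇒≼ (z , s) = just z , ⊕⇒∙ s

  ≼⇒≤ : ∀ {x y} → just x ≼ just y → x ≤ y
  ≼⇒≤ {x} (m , e) with ∙⇒⊕ (just x) m e
  ... | _ , z , refl , refl , s = z , s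

  ≼-just : ∀ {m y} → m ≼ just y → ∃[ x ] m ≡ just x × x ≤ y
  ≼-just {m} {y} m≼ with just-↓ {m} (↓-≼ {m} {just y} m≼ (↓-just y))
  ... | x , refl = x , refl , ≼⇒≤ m≼

  homogeneity : Homogeneous E → Homogeneity
  homogeneity hom {h} {x} {y} d h≼ with just-↓ {x ∙ y} (↓-≼ {x ∙ y} {h ∙ (x ∙ y)} (y≼x∙y {x ∙ y} {h}) d)
  ... | v , xy with ∙⇒⊕ x y xy
  ... | x , y , refl , refl , s rewrite ⊕⇒∙ s with ≼-just {h} {v} h≼
  ... | u , refl , u≤v with just-↓ {just u ∙ just v} d
  ... | w , uv
    with hom s u≤v
      -- Since `w` is the sum of `u` and `v`, the complement of `u` is the sum of `v` and `w ′`,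
      -- hence above `v`.
      (let k , t , e = Equivalence.to assoc (w , just⇒⊕ uv , complement-sum w)
       in w ′ , subst (v ⊕ w ′ ≔_) (sym (complement-unique e)) t)
  ... | u₁ , u₂ , u₁≤ , u₂≤ , e = just u₁ , just u₂ , ≤⇒≼ u₁≤ , ≤⇒≼ u₂≤ , ⊕⇒∙ e

  isPartialOrder : IsPartialOrder _≡_ _≤_
  isPartialOrder = record
    { isPreorder = record
      { isEquivalence = isEquivalence
      ; reflexive     = λ e → ≼⇒≤ (≼-reflexive {just _} {just _} (cong just e))
      ; trans         = λ {x} {y} {z} p q → ≼⇒≤ (≼-trans {just x} {just y} {just z} (≤⇒≼ p) (≤⇒≼ q))
      }
    ; antisym = λ {x} {y} p q → just-injective (≼-antisym {just y} {just x} (↓-just y) (≤⇒≼ p) (≤⇒≼ q))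
    }

  ′-antitone : ∀ {x y} → x ≤ y → y ′ ≤ x ′
  ′-antitone {x} {y} (z , s) with Equivalence.to assoc (y , s , complement-sum y)
  ... | v , t , e = z , comm (subst (z ⊕ y ′ ≔_) (sym (complement-unique e)) t)

  -- Joins are De Morgan duals of meets, the complement being an antitone involution.
  meets⇒latticeOrdered :
    (∀ x y → ∃[ m ] m ≤ x × m ≤ y × (∀ z → z ≤ x → z ≤ y → z ≤ m)) → LatticeOrdered E
  meets⇒latticeOrdered meet = join , (λ x y → proj₁ (meet x y)) , record
    { isPartialOrder = isPartialOrder
    ; supremum       = λ x y →
        let m , m≤x′ , m≤y′ , greatest = meet (x ′) (y ′)
            above : ∀ {x} → m ≤ x ′ → x ≤ m ′
            above {x} le = subst (_≤ m ′) (′-involutive x) (′-antitone le)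
        in above m≤x′ , above m≤y′ , λ z x≤z y≤z →
             subst (m ′ ≤_) (′-involutive z)
               (′-antitone (greatest (z ′) (′-antitone x≤z) (′-antitone y≤z)))
    ; infimum        = λ x y → proj₂ (meet x y)
    }
    where
    join : Carrier → Carrier → Carrier
    join x y = proj₁ (meet (x ′) (y ′)) ′

  module _ (ext : ∀ {a b} → Extensionality a b) (hom : Homogeneity) where

    open Bounds em ext effectMonoid hom
    open EffectMonoid effectMonoid using (rawMonoid)
    open import Algebra.Definitions.RawMonoid rawMonoid using () renaming (_×_ to _·_)

    ∑⇒⨁ : ∀ K {z} → ∑ (map just K) ≡ just z → ⨁ K ≔ z
    ∑⇒⨁ [] refl = []
    ∑⇒⨁ (x ∷ K) e with ∙⇒⊕ (just x) (∑ (map just K)) e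
    ... | _ , _ , refl , e′ , s = s ∷ ∑⇒⨁ K e′

    ⨁⇒∑ : ∀ {K z} → ⨁ K ≔ z → ∑ (map just K) ≡ just z
    ⨁⇒∑ []                = refl
    ⨁⇒∑ (_∷_ {x = x} s t) = trans (cong (just x ∙_) (⨁⇒∑ t)) (⊕⇒∙ s)

    ∑-replicate : ∀ n x → ∑ (map just (replicate n x)) ≡ n · just x
    ∑-replicate zero    x = refl
    ∑-replicate (suc n) x = cong (just x ∙_) (∑-replicate n x)

    archimedean : Archimedean E → ArchimedeanMonoid
    -- Every positive multiple of the adjoined element is undefined.
    archimedean arch nothing _ = 0 , λ
      { zero    _ → ℕ.z≤n
      ; (suc m) (_ , ()) }
    archimedean arch (just x) x≢ with arch x (x≢ ∘ cong just)
    ... | n , _ , _ , bound = n , λ m d →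
      let z , e = just-↓ {m · just x} d in bound m (z , ∑⇒⨁ (replicate m x) (trans (∑-replicate m x) e))

    ∑-defined : ∀ K → ↓ ∑ K → ∃[ K′ ] K ≡ map just K′
    ∑-defined [] _ = [] , refl
    ∑-defined (m ∷ K) d with just-↓ {m} (↓-≼ {m} {m ∙ ∑ K} (∑ K , refl) d)
      | ∑-defined K (↓-≼ {∑ K} {m ∙ ∑ K} (y≼x∙y {∑ K} {m}) d)
    ... | x , refl | K′ , refl = x ∷ K′ , refl

    -- Sums below `u` are defined, so their entries come from the carrier and `W+` applies to them.
    interpolatingBounds : W+ E → InterpolatingBounds
    interpolatingBounds w+ A {u} {v} ↓u ↓v sums≼u sums≼v with just-↓ {u} ↓u | just-↓ {v} ↓v
    ... | u , refl | v , refl =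
      let w , w-bound , w≤u , w≤v =
            w+ (A ∘ just) orthogonal (upper sums≼u) (upper sums≼v)
      in just w , (λ K unique K⊆A → below w w-bound K unique K⊆A) , ≤⇒≼ w≤u , ≤⇒≼ w≤v
      where
      finite : ∀ {K} → Unique K → All (A ∘ just) K → Unique (map just K) × All A (map just K)
      finite unique K⊆A = Unique.map⁺ just-injective unique , All.map⁺ K⊆A

      orthogonal : Orthogonal E (A ∘ just)
      orthogonal K (unique , K⊆A) =
        let unique′ , K⊆A′ = finite unique K⊆A
            z , e , _ = ≼-just {∑ (map just K)} {u} (sums≼u (map just K) unique′ K⊆A′)
        in z , ∑⇒⨁ K e

      upper : ∀ {t} → SumsBelow A (just t) → UpperBound E (_^⊕ E (A ∘ just)) t
      upper {t} sums≼ (K , (unique , K⊆A) , s) =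
        let unique′ , K⊆A′ = finite unique K⊆A
        in ≼⇒≤ (subst (_≼ just t) (⨁⇒∑ s) (sums≼ (map just K) unique′ K⊆A′))

      below : ∀ w → UpperBound E (_^⊕ E (A ∘ just)) w → SumsBelow A (just w)
      below w w-bound K unique K⊆A with ≼-just {∑ K} {u} (sums≼u K unique K⊆A)
      ... | z , e , _ with ∑-defined K (subst ↓_ (sym e) (↓-just z))
      ... | K′ , refl = subst (_≼ just w) (sym e)
        (≤⇒≼ (w-bound (K′ , (Unique.map⁻ unique , All.map⁻ K⊆A) , ∑⇒⨁ K′ e)))

-- Sub-effect algebras as subsets of the totalisation.

module Subalgebras (em : ∀ {a} → ExcludedMiddle a) (E : EffectAlgebra ℓ) where

  open EffectAlgebra E
  open Totalisation em E
  open EffectMonoidProperties effectMonoid using (↓-≼)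
  open RieszSubs effectMonoid using (IsRieszSub)

  Just : Pred Carrier ℓ → Pred M ℓ
  Just Q m = ∃[ x ] m ≡ just x × Q x

  module _ {R : Pred M ℓ} (isRiesz : IsRieszSub R) where
    open IsRieszSub isRiesz

    isSubEffectAlgebra : IsSubEffectAlgebra E (R ∘ just)
    isSubEffectAlgebra = record
      { 1∈  = ⊤∈
      ; xy∈ = λ {x} {y} s Rx Ry → subst R (⊕⇒∙ s) (sum Rx Ry (subst ↓_ (sym (⊕⇒∙ s)) (↓-just _)))
      ; xz∈ = λ s Rx Rz → diff Rx (subst R (sym (⊕⇒∙ s)) Rz)
      ; yz∈ = λ s Ry Rz → diff Ry (subst R (sym (⊕⇒∙ (comm s))) Rz)
      }

    rieszDecomposition : RieszDecomposition (subEffectAlgebra E (R ∘ just) isSubEffectAlgebra)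
    rieszDecomposition {u , [ Ru ]} {x , [ Rx ]} {y , [ Ry ]} {v , _} s (z , t)
      with riesz (recompute em Ru) (recompute em Rx) (recompute em Ry)
             (subst ↓_ (sym (⊕⇒∙ s)) (↓-just v)) (subst (just u ≼_) (sym (⊕⇒∙ s)) (≤⇒≼ (value z , t)))
    ... | m₁ , m₂ , R₁ , R₂ , m₁≼ , m₂≼ , e with ≼-just {m₁} {x} m₁≼ | ≼-just {m₂} {y} m₂≼
    ... | u₁ , refl , a , s₁ | u₂ , refl , b , s₂ =
      (u₁ , [ R₁ ]) , (u₂ , [ R₂ ]) ,
      ((a , [ xz∈ s₁ R₁ (recompute em Rx) ]) , s₁) ,
      ((b , [ xz∈ s₂ R₂ (recompute em Ry) ]) , s₂) ,
      just⇒⊕ e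
      where open IsSubEffectAlgebra isSubEffectAlgebra

  module _ {Q : Pred Carrier ℓ} (sub : IsSubEffectAlgebra E Q) where
    open IsSubEffectAlgebra sub

    private
      B = subEffectAlgebra E Q sub
      module B = EffectAlgebra B

    -- Excluded middle decides membership, and so recovers a proof from the irrelevant one.
    member : (x : B.Carrier) → Q (value x)
    member (_ , [ Qx ]) = recompute em Qx

    ≤-in-sub : ∀ x y → value x ≤ value y → x B.≤ y
    ≤-in-sub x y (z , s) = (z , [ xz∈ s (member x) (member y) ]) , s

    sub-≤ : ∀ x y → x B.≤ y → value x ≤ value y
    sub-≤ x y (z , s) = value z , s

    isRieszSub : RieszDecomposition B → IsRieszSub (Just Q)
    isRieszSub rd = record
      { defined = λ { (x , refl , _) → ↓-just x }
      ; ⊤∈      = 1# , refl , 1∈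
      ; compl   = λ { {_} {m} (x , refl , Qx) e → case ∙⇒⊕ (just x) m e of λ where
          (_ , y , refl , refl , s) → y , refl , xz∈ s Qx 1∈ }
      ; sum     = λ { (x , refl , Qx) (y , refl , Qy) d → case just-↓ d of λ where
          (z , e) → z , e , xy∈ (just⇒⊕ e) Qx Qy }
      ; riesz   = riesz
      }
      where
      riesz : ∀ {u x y} → Just Q u → Just Q x → Just Q y → ↓ x ∙ y → u ≼ x ∙ y →
              ∃[ u₁ ] ∃[ u₂ ] Just Q u₁ × Just Q u₂ × u₁ ≼ x × u₂ ≼ y × u₁ ∙ u₂ ≡ u
      riesz (u , refl , Qu) (x , refl , Qx) (y , refl , Qy) d u≼ with just-↓ {just x ∙ just y} d
      ... | v , e
        with rd {u , [ Qu ]} {x , [ Qx ]} {y , [ Qy ]} {v , [ xy∈ (just⇒⊕ e) Qx Qy ]} (just⇒⊕ e)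
               (≤-in-sub (u , [ Qu ]) (v , [ xy∈ (just⇒⊕ e) Qx Qy ]) (≼⇒≤ (subst (just u ≼_) e u≼)))
      ... | u₁ , u₂ , u₁≤x , u₂≤y , s =
        just (value u₁) , just (value u₂) ,
        (value u₁ , refl , member u₁) , (value u₂ , refl , member u₂) ,
        ≤⇒≼ (sub-≤ u₁ (x , [ Qx ]) u₁≤x) , ≤⇒≼ (sub-≤ u₂ (y , [ Qy ]) u₂≤y) , ⊕⇒∙ s

    sub-⨁ : ∀ {xs z} → B.⨁ xs ≔ z → ⨁ map value xs ≔ value z
    sub-⨁ B.[]      = []
    sub-⨁ (s B.∷ t) = s ∷ sub-⨁ t

    ⨁-in-sub : ∀ xs {z} → ⨁ map value xs ≔ z → Σ[ Qz ∈ Q z ] B.⨁ xs ≔ (z , [ Qz ])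
    ⨁-in-sub []       []      = 0∈ , B.[]
    ⨁-in-sub (x ∷ xs) (s ∷ t) = let Qy , t′ = ⨁-in-sub xs t
                                in xy∈ s (member x) Qy , s B.∷ t′

    sub-archimedean : Archimedean E → Archimedean B
    sub-archimedean arch x x≢0 with arch (value x) (x≢0 ∘ value-injective)
    ... | n , 1≤n , (z , s) , bound =
      n , 1≤n , (_ , proj₂ (⨁-in-sub (replicate n x) (subst (⨁_≔ z) (sym (map-replicate value n x)) s))) ,
      λ m (y , t) → bound m (value y , subst (⨁_≔ value y) (map-replicate value m x) (sub-⨁ t))

-- Covering by blocks and their lattice order.

module _ (em : ∀ {a} → ExcludedMiddle a) (ext : ∀ {a b} → Extensionality a b)
  (E : EffectAlgebra ℓ) (hom : Homogeneous E) where

  open EffectAlgebra E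
  open Totalisation em E
  open Subalgebras em E
  open Blocks em ext effectMonoid (homogeneity hom) using (IsMaximalRieszSub; element-in-block)

  unionOfBlocks : UnionOfBlocks E
  unionOfBlocks x with element-in-block (↓-just x)
  ... | R , maxR , Rx = R ∘ just , record
    { isSubEffectAlgebra = isSubEffectAlgebra M.isRieszSub
    ; riesz              = λ {u} {x} {y} {v} → rieszDecomposition M.isRieszSub {u} {x} {y} {v}
    ; maximal            = λ P sub rd R⊆P Py → M.maximal (Just P)
        (isRieszSub sub λ {u} {x} {y} {v} → rd {u} {x} {y} {v})
        (λ Rm → let y , e = just-↓ (M.defined Rm) in y , e , R⊆P (subst R e Rm))
        (_ , refl , Py)
    } , Rx
    where module M = IsMaximalRieszSub maxR

  module _ (arch : Archimedean E) (w+ : W+ E) {Q : Pred Carrier ℓ} (B : IsBlock E Q) where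
    open IsBlock B renaming (isSubEffectAlgebra to sub)

    -- Members of `R` are defined, hence come from the carrier, and maximality of the block carries
    -- over.
    isMaximalRieszSub : IsMaximalRieszSub (Just Q)
    isMaximalRieszSub = record
      { isRieszSub = isRieszSub sub λ {u} {x} {y} {v} → riesz {u} {x} {y} {v}
      ; maximal    = λ R subR Q⊆R Rm →
          let y , e = just-↓ (IsRieszSub.defined subR Rm)
          in y , e , maximal (R ∘ just) (isSubEffectAlgebra subR)
               (λ {u} {x} {y} {v} → rieszDecomposition subR {u} {x} {y} {v})
               (λ Qx → Q⊆R (_ , refl , Qx)) (subst R e Rm)
      }
      where open RieszSubs effectMonoid using (module IsRieszSub)

    open Meets em ext effectMonoid (homogeneity hom)
      (archimedean ext (homogeneity hom) arch) (interpolatingBounds ext (homogeneity hom) w+)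
      isMaximalRieszSub

    block-latticeOrdered : LatticeOrdered block
    block-latticeOrdered = Totalisation.meets⇒latticeOrdered em block λ x y →
      case meet (_ , refl , member sub x) (_ , refl , member sub y) of λ where
        (_ , (m , refl , Qm) , m≼x , m≼y , greatest) →
          (m , [ Qm ]) , ≤-in-sub sub (m , [ Qm ]) x (≼⇒≤ m≼x) , ≤-in-sub sub (m , [ Qm ]) y (≼⇒≤ m≼y) ,
          λ z z≤x z≤y → ≤-in-sub sub z (m , [ Qm ]) (≼⇒≤ (greatest (_ , refl , member sub z)
            (≤⇒≼ (sub-≤ sub z x z≤x)) (≤⇒≼ (sub-≤ sub z y z≤y))))

corollary3p14 : (∀ {a} → ExcludedMiddle a) → (∀ {a b} → Extensionality a b) →
    ∀ {ℓ} (E : EffectAlgebra ℓ) →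
    Archimedean E → Homogeneous E → W+ E →
    UnionOfBlocks E ×
    (∀ (Q : Pred (EffectAlgebra.Carrier E) ℓ) (B : IsBlock E Q) →
    LatticeOrdered (IsBlock.block B) × IsMV (IsBlock.block B) × Archimedean (IsBlock.block B))
corollary3p14 em ext E arch hom w+ = unionOfBlocks em ext E hom , λ Q B →
  let lattice = block-latticeOrdered em ext E hom arch w+ B in
  lattice , (lattice , λ {u} {x} {y} {v} → IsBlock.riesz B {u} {x} {y} {v}) ,
  Subalgebras.sub-archimedean em E (IsBlock.isSubEffectAlgebra B) arch
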